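{- Let $(\mathcal{B},\mathbb{C},F,\mathbb{H})$ be a geminal category and $\Box=\gamma_{\mathbb C}\circ F:\mathcal B\to\mathcal B$. Then the pair $(\mathcal{B},\Box)$ can be equipped with the following additional structures: 1. A natural transformation $\delta:\Box\Rightarrow\Box\Box$ satisfying the co-associative law $(\delta\Box)\circ\delta=(\Box\delta)\circ\delta$. 2. A family of functions $(-)^{\dagger}_{A,B}:\mathcal{B}(B\times\Box A,A)\to\mathcal{B}(\Box B,\Box A)$ (for $A,B\in\mathcal B$), natural in $B\in\mathcal{B}$, such that for any $f:B\times\Box A\to A$ the morphism $f^\dagger:\Box B\to\Box A$ equals the composite $$\Box B\xrightarrow{\langle\mathrm{id},\,\delta_A\circ f^\dagger\rangle}\Box B\times\Box\Box A\xrightarrow{\ \cong\ }\Box(B\times\Box A)\xrightarrow{\ \Box f\ }\Box A,$$ where the isomorphism is the canonical one (since $\Box$ preserves finite products).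
   Context: Internal categories. Let $\mathcal B$ be a locally small category with finite limits (a terminal object $1$ and pullbacks). A $\mathcal B$-internal category $\mathbb C$ has an object of objects $|\mathbb C|$, an object of morphisms $|\mathbb C^{\to}|$, morphisms $\mathrm{dom},\mathrm{cod}:|\mathbb C^\to|\to|\mathbb C|$, identities $e:|\mathbb C|\to|\mathbb C^\to|$ and a composition $\circ$ defined on the object of composable pairs (written in diagrammatic order), satisfying the usual axioms. An internal functor $\mathbb H:\mathbb C\to\mathbb D$ is a pair $|\mathbb H|:|\mathbb C|\to|\mathbb D|$, $|\mathbb H^\to|:|\mathbb C^\to|\to|\mathbb D^\to|$ commuting with this structure. A global object $X\in_1\mathbb C$ is a morphism $X:1\to|\mathbb C|$; $\mathbb HX=|\mathbb H|\circ X$. The hom-object $\mathbb C(X,Y)$ is the pullback of $\langle\mathrm{dom},\mathrm{cod}\rangle:|\mathbb C^\to|\to|\mathbb C|\times|\mathbb C|$ along $\langle X,Y\rangle:1\to|\mathbb C|\times|\mathbb C|$; its global elements (morphisms from $1$) are identified with global elements of $|\mathbb C^\to|$ with domain $X$ and codomain $Y$. Composition induces $\circ_{\mathbb C}:\mathbb C(X,Y)\times\mathbb C(Y,Z)\to\mathbb C(X,Z)$ and $\mathbb H$ induces $\mathbb H_{X,Y}:\mathbb C(X,Y)\to\mathbb D(\mathbb HX,\mathbb HY)$. The underlying category $\Gamma\mathbb C$ has global objects as objects and global elements of $\mathbb C(X,Y)$ as morphisms $X\to Y$; $\mathbb H$ induces a functor $\Gamma\mathbb H$. $\mathbb C$ has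 chosen finite limits if it is equipped with an internal chosen terminal object $1_{\mathbb C}\in_1\mathbb C$ and internal chosen pullbacks (given by morphisms of $\mathcal B$ expressing a choice of pullback squares and of mediating arrows, satisfying the evident internal equations); then $\Gamma\mathbb C$ has induced chosen finite limits. The global section functor is $\gamma_{\mathbb C}=\mathbb C(1_{\mathbb C},-):\Gamma\mathbb C\to\mathcal B$ (acting on morphisms by $\circ_{\mathbb C}$); it preserves finite limits. If $G:\mathcal B\to\mathcal B'$ preserves finite limits, $G\mathbb C$ is the $\mathcal B'$-internal category obtained by applying $G$ to all data of $\mathbb C$ (with induced chosen finite limits), $G\mathbb H$ is defined similarly for internal functors, and $G^{\#}_{\mathbb C}:\Gamma\mathbb C\to\Gamma G\mathbb C$ is the functor sending a global object $X$ to $1\cong G1\xrightarrow{GX}G|\mathbb C|$, and likewise on global morphisms; canonically $(G\mathbb C)(G^\#X,G^\#Y)\cong G(\mathbb C(X,Y))$. Pre-geminal category. It consists of: (I) a category $\mathcal B$ with chosen finite limits; (II) a $\mathcal B$-internal category $\mathbb C$ with chosen finite limits; (III) a functor $F:\mathcal B\to\Gamma\mathbb C$ strictly preserving the chosen finite limits; put $\Box=\gamma_{\mathbb C}\circ F:\mathcal B\to\mathcal B$, so $\Box A=\mathbb C(1_{\mathbb C},FA)$ (it preserves finite limits); (IV) a $\mathcal B$-internal functor $\mathbb H:\mathbb C\to\Box\mathbb C$ satisfying $\Gamma\mathbb H\circ F=F^{\#}_{\mathbb C}\circ F$, where the codomain $\Gamma F\mathbb C$ of $F^\#_{\mathbb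 C}$ is identified with $\Gamma\Box\mathbb C=\Gamma\gamma_{\mathbb C}F\mathbb C$ by the canonical isomorphism. Unfolded: with $u:1\cong\Box1$ the unique isomorphism, $|\mathbb H|\circ FA=\Box(FA)\circ u$ for every object $A$ of $\mathcal B$, and $|\mathbb H^\to|\circ Ff=\Box(Ff)\circ u$ for every morphism $f$ of $\mathcal B$, where $FA:1\to|\mathbb C|$ and $Ff:1\to|\mathbb C^\to|$. In particular $\mathbb HFA=\Box^\#FA$, whence a canonical isomorphism $(\Box\mathbb C)(\mathbb HFA,\mathbb HFB)\cong\Box(\mathbb C(FA,FB))$ for all $A,B\in\mathcal B$ (and $F1=1_{\mathbb C}$). Geminal category. It is a pre-geminal category such that $\mathbb H$ strictly preserves the chosen finite limits and $\Box\mathbb H\circ\mathbb H=\mathbb H^{\#}_{F\mathbb C}\circ\mathbb H$ as internal functors $\mathbb C\to\Box\Box\mathbb C$. Here $\mathbb H^\#_{F\mathbb C}:\Box\mathbb C=\gamma_{\mathbb C}F\mathbb C\to\Box\Box\mathbb C$ is the $\mathcal B$-internal functor given on objects by $\sigma_{|\mathbb C|}:\Box|\mathbb C|\to\Box\Box|\mathbb C|$ and on morphisms by $\sigma_{|\mathbb C^\to|}:\Box|\mathbb C^\to|\to\Box\Box|\mathbb C^\to|$, where for $A\in\mathcal B$, $\sigma_A$ is the composite $\Box A=\mathbb C(1_{\mathbb C},FA)\xrightarrow{\mathbb H_{1_{\mathbb C},FA}}(\Box\mathbb C)(\mathbb H1_{\mathbb C},\mathbb HFA)\cong\Box(\mathbb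 C(1_{\mathbb C},FA))=\Box\Box A$. Naturality in $B$ of $(-)^\dagger$ means $(f\circ(g\times\mathrm{id}_{\Box A}))^\dagger=f^\dagger\circ\Box g$ for all $g:B'\to B$ and $f:B\times\Box A\to A$. -}

module Defs where

open import Level using (Level; _⊔_) renaming (suc to lsuc)
open import Relation.Binary.Core using (Rel)
open import Relation.Binary.Bundles using (Setoid)
open import Relation.Binary.Structures using (IsEquivalence)
import Relation.Binary.Reasoning.Setoid as SetoidR

-- The hom-sets are setoids; "equal morphisms" always means _≈_.
-- The no-eta-equality and INLINE annotations on this and later records
-- (INLINE turns record expressions into copattern clauses) only keep
-- conversion checking tractable.
record Category (o ℓ e : Level) : Set (lsuc (o ⊔ ℓ ⊔ e)) where
  no-eta-equality
  infix  4 _≈_ _⇒_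
  infixr 9 _∘_
  field
    Obj       : Set o
    _⇒_       : Obj → Obj → Set ℓ
    _≈_       : ∀ {A B} → Rel (A ⇒ B) e
    id        : ∀ {A} → A ⇒ A
    _∘_       : ∀ {A B C} → B ⇒ C → A ⇒ B → A ⇒ C
    assoc     : ∀ {A B C D} {f : A ⇒ B} {g : B ⇒ C} {h : C ⇒ D} →
                (h ∘ g) ∘ f ≈ h ∘ (g ∘ f)
    identityˡ : ∀ {A B} {f : A ⇒ B} → id ∘ f ≈ f
    identityʳ : ∀ {A B} {f : A ⇒ B} → f ∘ id ≈ f
    equiv     : ∀ {A B} → IsEquivalence (_≈_ {A} {B})
    ∘-resp-≈  : ∀ {A B C} {f h : B ⇒ C} {g i : A ⇒ B} →
                f ≈ h → g ≈ i → f ∘ g ≈ h ∘ i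

  module Equiv {A B : Obj} = IsEquivalence (equiv {A} {B})

  hom-setoid : Obj → Obj → Setoid ℓ e
  hom-setoid A B = record { Carrier = A ⇒ B ; _≈_ = _≈_ ; isEquivalence = equiv }

  ∘-respˡ : ∀ {A B C} {f h : B ⇒ C} {g : A ⇒ B} → f ≈ h → f ∘ g ≈ h ∘ g
  ∘-respˡ p = ∘-resp-≈ p Equiv.refl

  ∘-respʳ : ∀ {A B C} {f : B ⇒ C} {g i : A ⇒ B} → g ≈ i → f ∘ g ≈ f ∘ i
  ∘-respʳ p = ∘-resp-≈ Equiv.refl p

  sym-assoc : ∀ {A B C D} {f : A ⇒ B} {g : B ⇒ C} {h : C ⇒ D} →
              h ∘ (g ∘ f) ≈ (h ∘ g) ∘ f
  sym-assoc = Equiv.sym assoc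

  pullˡ : ∀ {A B C D} {f : C ⇒ D} {g : B ⇒ C} {k : B ⇒ D} {h : A ⇒ B} →
          f ∘ g ≈ k → f ∘ (g ∘ h) ≈ k ∘ h
  pullˡ p = Equiv.trans sym-assoc (∘-respˡ p)

  extendʳ : ∀ {A B C C′ D} {f : C ⇒ D} {g : B ⇒ C} {f′ : C′ ⇒ D} {g′ : B ⇒ C′}
            {h : A ⇒ B} → f ∘ g ≈ f′ ∘ g′ → f ∘ (g ∘ h) ≈ f′ ∘ (g′ ∘ h)
  extendʳ p = Equiv.trans (pullˡ p) assoc

  record _≅_ (A B : Obj) : Set (ℓ ⊔ e) where
    field
      to   : A ⇒ B
      from : B ⇒ A
      isoˡ : from ∘ to ≈ id
      isoʳ : to ∘ from ≈ id

  module HomReasoning {A B : Obj} where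
    open SetoidR (hom-setoid A B) public
{-# INLINE Category.constructor #-}

record Functor {o ℓ e o′ ℓ′ e′} (𝓒 : Category o ℓ e) (𝓓 : Category o′ ℓ′ e′)
       : Set (o ⊔ ℓ ⊔ e ⊔ o′ ⊔ ℓ′ ⊔ e′) where
  no-eta-equality
  private
    module C = Category 𝓒
    module D = Category 𝓓
  field
    F₀           : C.Obj → D.Obj
    F₁           : ∀ {A B} → A C.⇒ B → F₀ A D.⇒ F₀ B
    identity     : ∀ {A} → F₁ (C.id {A}) D.≈ D.id
    homomorphism : ∀ {X Y Z} {f : X C.⇒ Y} {g : Y C.⇒ Z} →
                   F₁ (g C.∘ f) D.≈ F₁ g D.∘ F₁ f
    F-resp-≈     : ∀ {A B} {f g : A C.⇒ B} → f C.≈ g → F₁ f D.≈ F₁ g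

  F-square : ∀ {A B B′ D′} {f : B C.⇒ D′} {g : A C.⇒ B} {h : B′ C.⇒ D′} {k : A C.⇒ B′} →
             f C.∘ g C.≈ h C.∘ k → F₁ f D.∘ F₁ g D.≈ F₁ h D.∘ F₁ k
  F-square p = D.Equiv.trans (D.Equiv.sym homomorphism)
                 (D.Equiv.trans (F-resp-≈ p) homomorphism)

  F-triangle : ∀ {A B D′} {f : B C.⇒ D′} {g : A C.⇒ B} {h : A C.⇒ D′} →
               f C.∘ g C.≈ h → F₁ f D.∘ F₁ g D.≈ F₁ h
  F-triangle p = D.Equiv.trans (D.Equiv.sym homomorphism) (F-resp-≈ p)
{-# INLINE Functor.constructor #-}

infixr 9 _∘F_

_∘F_ : ∀ {o ℓ e o′ ℓ′ e′ o″ ℓ″ e″}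
       {𝓒 : Category o ℓ e} {𝓓 : Category o′ ℓ′ e′} {𝓔 : Category o″ ℓ″ e″} →
       Functor 𝓓 𝓔 → Functor 𝓒 𝓓 → Functor 𝓒 𝓔
_∘F_ {𝓔 = 𝓔} G F = record
  { F₀           = λ A → G.F₀ (F.F₀ A)
  ; F₁           = λ f → G.F₁ (F.F₁ f)
  ; identity     = E.Equiv.trans (G.F-resp-≈ F.identity) G.identity
  ; homomorphism = E.Equiv.trans (G.F-resp-≈ F.homomorphism) G.homomorphism
  ; F-resp-≈     = λ p → G.F-resp-≈ (F.F-resp-≈ p)
  }
  where
    module E = Category 𝓔
    module G = Functor G
    module F = Functor F

record NaturalTransformation {o ℓ e o′ ℓ′ e′}
       {𝓒 : Category o ℓ e} {𝓓 : Category o′ ℓ′ e′} (F G : Functor 𝓒 𝓓)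
       : Set (o ⊔ ℓ ⊔ e ⊔ o′ ⊔ ℓ′ ⊔ e′) where
  no-eta-equality
  private
    module C = Category 𝓒
    module D = Category 𝓓
    module F = Functor F
    module G = Functor G
  field
    η       : ∀ A → F.F₀ A D.⇒ G.F₀ A
    natural : ∀ {A B} (f : A C.⇒ B) → η B D.∘ F.F₁ f D.≈ G.F₁ f D.∘ η A
{-# INLINE NaturalTransformation.constructor #-}

module _ {o ℓ e} (𝓑 : Category o ℓ e) where
  open Category 𝓑

  record IsTerminal (T : Obj) : Set (o ⊔ ℓ ⊔ e) where
    no-eta-equality
    field
      !        : ∀ {A} → A ⇒ T
      !-unique : ∀ {A} (f : A ⇒ T) → ! ≈ f

    !-unique₂ : ∀ {A} {f g : A ⇒ T} → f ≈ g
    !-unique₂ {f = f} {g} = Equiv.trans (Equiv.sym (!-unique f)) (!-unique g)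
  {-# INLINE IsTerminal.constructor #-}

  record IsPullback {P A B C : Obj} (p₁ : P ⇒ A) (p₂ : P ⇒ B) (f : A ⇒ C) (g : B ⇒ C)
         : Set (o ⊔ ℓ ⊔ e) where
    no-eta-equality
    field
      commute      : f ∘ p₁ ≈ g ∘ p₂
      universal    : ∀ {T} (h : T ⇒ A) (k : T ⇒ B) → f ∘ h ≈ g ∘ k → T ⇒ P
      p₁∘universal : ∀ {T} {h : T ⇒ A} {k : T ⇒ B} {eq : f ∘ h ≈ g ∘ k} →
                     p₁ ∘ universal h k eq ≈ h
      p₂∘universal : ∀ {T} {h : T ⇒ A} {k : T ⇒ B} {eq : f ∘ h ≈ g ∘ k} →
                     p₂ ∘ universal h k eq ≈ k
      unique       : ∀ {T} {u v : T ⇒ P} → p₁ ∘ u ≈ p₁ ∘ v → p₂ ∘ u ≈ p₂ ∘ v → u ≈ v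
  {-# INLINE IsPullback.constructor #-}

  record Pullback {A B C : Obj} (f : A ⇒ C) (g : B ⇒ C) : Set (o ⊔ ℓ ⊔ e) where
    no-eta-equality
    field
      {P}        : Obj
      p₁         : P ⇒ A
      p₂         : P ⇒ B
      isPullback : IsPullback p₁ p₂ f g
    open IsPullback isPullback public
  {-# INLINE Pullback.constructor #-}

  record FiniteLimits : Set (o ⊔ ℓ ⊔ e) where
    no-eta-equality
    field
      ⊤          : Obj
      ⊤-terminal : IsTerminal ⊤
      pullback   : ∀ {A B C} (f : A ⇒ C) (g : B ⇒ C) → Pullback f g

    open IsTerminal ⊤-terminal public

    infixr 7 _×̂_ _⁂_

    product : ∀ A B → Pullback (! {A}) (! {B})
    product A B = pullback ! !

    _×̂_ : Obj → Obj → Obj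
    A ×̂ B = Pullback.P (product A B)

    π₁ : ∀ {A B} → A ×̂ B ⇒ A
    π₁ {A} {B} = Pullback.p₁ (product A B)

    π₂ : ∀ {A B} → A ×̂ B ⇒ B
    π₂ {A} {B} = Pullback.p₂ (product A B)

    ⟨_,_⟩ : ∀ {T A B} → T ⇒ A → T ⇒ B → T ⇒ A ×̂ B
    ⟨_,_⟩ {A = A} {B} f g = Pullback.universal (product A B) f g !-unique₂

    _⁂_ : ∀ {A A′ B B′} → A ⇒ A′ → B ⇒ B′ → A ×̂ B ⇒ A′ ×̂ B′
    f ⁂ g = ⟨ f ∘ π₁ , g ∘ π₂ ⟩

    π₁-⟨⟩ : ∀ {T A B} {f : T ⇒ A} {g : T ⇒ B} → π₁ ∘ ⟨ f , g ⟩ ≈ f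
    π₁-⟨⟩ {A = A} {B} = Pullback.p₁∘universal (product A B)

    π₂-⟨⟩ : ∀ {T A B} {f : T ⇒ A} {g : T ⇒ B} → π₂ ∘ ⟨ f , g ⟩ ≈ g
    π₂-⟨⟩ {A = A} {B} = Pullback.p₂∘universal (product A B)

    ×-unique : ∀ {T A B} {u v : T ⇒ A ×̂ B} → π₁ ∘ u ≈ π₁ ∘ v → π₂ ∘ u ≈ π₂ ∘ v → u ≈ v
    ×-unique {A = A} {B} = Pullback.unique (product A B)
  {-# INLINE FiniteLimits.constructor #-}

module _ {o ℓ e o′ ℓ′ e′} {𝓒 : Category o ℓ e} {𝓓 : Category o′ ℓ′ e′} where
  private
    module C = Category 𝓒
    module D = Category 𝓓

  record PreservesFiniteLimits (G : Functor 𝓒 𝓓) : Set (o ⊔ ℓ ⊔ e ⊔ o′ ⊔ ℓ′ ⊔ e′) where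
    no-eta-equality
    open Functor G
    field
      pres-terminal : ∀ {T} → IsTerminal 𝓒 T → IsTerminal 𝓓 (F₀ T)
      pres-pullback : ∀ {P A B C} {p₁ : P C.⇒ A} {p₂ : P C.⇒ B} {f : A C.⇒ C} {g : B C.⇒ C} →
                      IsPullback 𝓒 p₁ p₂ f g → IsPullback 𝓓 (F₁ p₁) (F₁ p₂) (F₁ f) (F₁ g)

    mapPullback : ∀ {A B C} {f : A C.⇒ C} {g : B C.⇒ C} →
                  Pullback 𝓒 f g → Pullback 𝓓 (F₁ f) (F₁ g)
    mapPullback p = record { isPullback = pres-pullback (Pullback.isPullback p) }
  {-# INLINE PreservesFiniteLimits.constructor #-}

  module _ (L : FiniteLimits 𝓒) (G : Functor 𝓒 𝓓) where
    private
      module L = FiniteLimits L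
      open Functor G
      open D.HomReasoning

    preservesChosen⇒preserves :
      IsTerminal 𝓓 (F₀ L.⊤) →
      (∀ {A B C} (f : A C.⇒ C) (g : B C.⇒ C) →
         IsPullback 𝓓 (F₁ (Pullback.p₁ (L.pullback f g))) (F₁ (Pullback.p₂ (L.pullback f g)))
                      (F₁ f) (F₁ g)) →
      PreservesFiniteLimits G
    preservesChosen⇒preserves GT GP = record
      { pres-terminal = λ {T} isT →
          let module T = IsTerminal isT
              module GT = IsTerminal GT
          in record
          { !        = F₁ T.! D.∘ GT.!
          ; !-unique = λ f → begin
              F₁ T.! D.∘ GT.!              ≈⟨ D.∘-respʳ (GT.!-unique _) ⟩
              F₁ T.! D.∘ (F₁ L.! D.∘ f)    ≈⟨ D.pullˡ (F-triangle T.!-unique₂) ⟩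
              F₁ C.id D.∘ f                ≈⟨ D.∘-respˡ identity ⟩
              D.id D.∘ f                   ≈⟨ D.identityˡ ⟩
              f                            ∎
          }
      ; pres-pullback = λ {_} {_} {_} {_} {p₁} {p₂} {f} {g} isP →
          let module P = IsPullback isP
              module Q = Pullback (L.pullback f g)
              module GQ = IsPullback (GP f g)
              u = Q.universal p₁ p₂ P.commute
              v = P.universal Q.p₁ Q.p₂ Q.commute
              vu : v C.∘ u C.≈ C.id
              vu = P.unique
                (C.Equiv.trans (C.pullˡ P.p₁∘universal)
                  (C.Equiv.trans Q.p₁∘universal (C.Equiv.sym C.identityʳ)))
                (C.Equiv.trans (C.pullˡ P.p₂∘universal)
                  (C.Equiv.trans Q.p₂∘universal (C.Equiv.sym C.identityʳ)))
              GvGu : ∀ {T} (h : T D.⇒ _) → F₁ v D.∘ (F₁ u D.∘ h) D.≈ h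
              GvGu h = begin
                F₁ v D.∘ (F₁ u D.∘ h) ≈⟨ D.pullˡ (F-triangle vu) ⟩
                F₁ C.id D.∘ h         ≈⟨ D.∘-respˡ identity ⟩
                D.id D.∘ h            ≈⟨ D.identityˡ ⟩
                h                     ∎
          in record
          { commute      = F-square P.commute
          ; universal    = λ h k eq → F₁ v D.∘ GQ.universal h k eq
          ; p₁∘universal = D.Equiv.trans (D.pullˡ (F-triangle P.p₁∘universal)) GQ.p₁∘universal
          ; p₂∘universal = D.Equiv.trans (D.pullˡ (F-triangle P.p₂∘universal)) GQ.p₂∘universal
          ; unique       = λ {_} {h} {k} e₁ e₂ → begin
              h                     ≈⟨ GvGu h ⟨
              F₁ v D.∘ (F₁ u D.∘ h) ≈⟨ D.∘-respʳ (GQ.unique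
                  (D.Equiv.trans (D.pullˡ (F-triangle Q.p₁∘universal))
                    (D.Equiv.trans e₁ (D.Equiv.sym (D.pullˡ (F-triangle Q.p₁∘universal)))))
                  (D.Equiv.trans (D.pullˡ (F-triangle Q.p₂∘universal))
                    (D.Equiv.trans e₂ (D.Equiv.sym (D.pullˡ (F-triangle Q.p₂∘universal)))))) ⟩
              F₁ v D.∘ (F₁ u D.∘ k) ≈⟨ GvGu k ⟩
              k                     ∎
          }
      }

  module _ (L : FiniteLimits 𝓒) (L′ : FiniteLimits 𝓓)
           {G : Functor 𝓒 𝓓} (pres : PreservesFiniteLimits G) where
    private
      module L = FiniteLimits L
      module L′ = FiniteLimits L′
      open Functor G
      open PreservesFiniteLimits pres

    G⊤-terminal : IsTerminal 𝓓 (F₀ L.⊤)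
    G⊤-terminal = pres-terminal L.⊤-terminal

    ⊤⇒G⊤ : L′.⊤ D.⇒ F₀ L.⊤
    ⊤⇒G⊤ = IsTerminal.! G⊤-terminal

    -- the inverse of the canonical comparison ⟨ Gπ₁ , Gπ₂ ⟩
    ×≅G× : ∀ A B → (F₀ A L′.×̂ F₀ B) D.≅ F₀ (A L.×̂ B)
    ×≅G× A B = record
      { to   = G×.universal L′.π₁ L′.π₂ (IsTerminal.!-unique₂ G⊤-terminal)
      ; from = L′.⟨ F₁ L.π₁ , F₁ L.π₂ ⟩
      ; isoˡ = L′.×-unique
          (D.Equiv.trans (D.pullˡ L′.π₁-⟨⟩)
            (D.Equiv.trans G×.p₁∘universal (D.Equiv.sym D.identityʳ)))
          (D.Equiv.trans (D.pullˡ L′.π₂-⟨⟩)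
            (D.Equiv.trans G×.p₂∘universal (D.Equiv.sym D.identityʳ)))
      ; isoʳ = G×.unique
          (D.Equiv.trans (D.pullˡ G×.p₁∘universal)
            (D.Equiv.trans L′.π₁-⟨⟩ (D.Equiv.sym D.identityʳ)))
          (D.Equiv.trans (D.pullˡ G×.p₂∘universal)
            (D.Equiv.trans L′.π₂-⟨⟩ (D.Equiv.sym D.identityʳ)))
      }
      where module G× = Pullback (mapPullback (L.product A B))

    G×-unique : ∀ {T A B} {u v : T D.⇒ F₀ (A L.×̂ B)} →
                F₁ L.π₁ D.∘ u D.≈ F₁ L.π₁ D.∘ v → F₁ L.π₂ D.∘ u D.≈ F₁ L.π₂ D.∘ v → u D.≈ v
    G×-unique {A = A} {B} = Pullback.unique (mapPullback (L.product A B))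

pres-∘ : ∀ {o ℓ e o′ ℓ′ e′ o″ ℓ″ e″}
         {𝓒 : Category o ℓ e} {𝓓 : Category o′ ℓ′ e′} {𝓔 : Category o″ ℓ″ e″}
         {G : Functor 𝓓 𝓔} {F : Functor 𝓒 𝓓} →
         PreservesFiniteLimits G → PreservesFiniteLimits F → PreservesFiniteLimits (G ∘F F)
pres-∘ g f = record
  { pres-terminal = λ t → G.pres-terminal (F.pres-terminal t)
  ; pres-pullback = λ p → G.pres-pullback (F.pres-pullback p)
  }
  where
    module G = PreservesFiniteLimits g
    module F = PreservesFiniteLimits f

-- The objects of composable pairs and triples are part of the data, as
-- arbitrary pullbacks; this way a pullback-preserving functor can be
-- applied to an internal category componentwise.
record InternalCategory {o ℓ e} (𝓑 : Category o ℓ e) : Set (o ⊔ ℓ ⊔ e) where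
  no-eta-equality
  open Category 𝓑
  field
    C₀ C₁      : Obj
    dom cod    : C₁ ⇒ C₀
    ε          : C₀ ⇒ C₁
    dom-ε      : dom ∘ ε ≈ id
    cod-ε      : cod ∘ ε ≈ id
    composable : Pullback 𝓑 cod dom

  module C₂ = Pullback composable

  field
    comp     : C₂.P ⇒ C₁
    dom-comp : dom ∘ comp ≈ dom ∘ C₂.p₁
    cod-comp : cod ∘ comp ≈ cod ∘ C₂.p₂

  -- Composition of generalised elements, in diagrammatic order.
  _⨾_[_] : ∀ {T} (f g : T ⇒ C₁) → cod ∘ f ≈ dom ∘ g → T ⇒ C₁
  f ⨾ g [ p ] = comp ∘ C₂.universal f g p

  field
    triple : Pullback 𝓑 C₂.p₂ C₂.p₁

  module C₃ = Pullback triple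

  cod-ε∘dom : cod ∘ (ε ∘ dom) ≈ dom ∘ id
  cod-ε∘dom = Equiv.trans (pullˡ cod-ε) (Equiv.trans identityˡ (Equiv.sym identityʳ))

  dom-ε∘cod : cod ∘ id ≈ dom ∘ (ε ∘ cod)
  dom-ε∘cod = Equiv.sym
    (Equiv.trans (pullˡ dom-ε) (Equiv.trans identityˡ (Equiv.sym identityʳ)))

  assoc-eqˡ : cod ∘ (comp ∘ C₃.p₁) ≈ dom ∘ (C₂.p₂ ∘ C₃.p₂)
  assoc-eqˡ = Equiv.trans (extendʳ cod-comp)
    (Equiv.trans (∘-respʳ C₃.commute) (extendʳ C₂.commute))

  assoc-eqʳ : cod ∘ (C₂.p₁ ∘ C₃.p₁) ≈ dom ∘ (comp ∘ C₃.p₂)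
  assoc-eqʳ = Equiv.trans (extendʳ C₂.commute)
    (Equiv.trans (∘-respʳ C₃.commute) (Equiv.sym (extendʳ dom-comp)))

  field
    comp-identityˡ : (ε ∘ dom) ⨾ id [ cod-ε∘dom ] ≈ id
    comp-identityʳ : id ⨾ (ε ∘ cod) [ dom-ε∘cod ] ≈ id
    comp-assoc     : (comp ∘ C₃.p₁) ⨾ (C₂.p₂ ∘ C₃.p₂) [ assoc-eqˡ ] ≈
                     (C₂.p₁ ∘ C₃.p₁) ⨾ (comp ∘ C₃.p₂) [ assoc-eqʳ ]

  ⨾-resp : ∀ {T} {f f′ g g′ : T ⇒ C₁} {p : cod ∘ f ≈ dom ∘ g} {p′ : cod ∘ f′ ≈ dom ∘ g′} →
           f ≈ f′ → g ≈ g′ → f ⨾ g [ p ] ≈ f′ ⨾ g′ [ p′ ]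
  ⨾-resp a b = ∘-respʳ (C₂.unique
    (Equiv.trans C₂.p₁∘universal (Equiv.trans a (Equiv.sym C₂.p₁∘universal)))
    (Equiv.trans C₂.p₂∘universal (Equiv.trans b (Equiv.sym C₂.p₂∘universal))))

  comp∘ : ∀ {T} {t : T ⇒ C₂.P} {f g : T ⇒ C₁} {p : cod ∘ f ≈ dom ∘ g} →
          C₂.p₁ ∘ t ≈ f → C₂.p₂ ∘ t ≈ g → comp ∘ t ≈ f ⨾ g [ p ]
  comp∘ a b = ∘-respʳ (C₂.unique
    (Equiv.trans a (Equiv.sym C₂.p₁∘universal))
    (Equiv.trans b (Equiv.sym C₂.p₂∘universal)))

  ⨾-∘ : ∀ {T S} {t : S ⇒ T} {f g : T ⇒ C₁} {p : cod ∘ f ≈ dom ∘ g}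
        {p′ : cod ∘ (f ∘ t) ≈ dom ∘ (g ∘ t)} →
        (f ⨾ g [ p ]) ∘ t ≈ (f ∘ t) ⨾ (g ∘ t) [ p′ ]
  ⨾-∘ = Equiv.trans assoc
    (comp∘ (pullˡ C₂.p₁∘universal) (pullˡ C₂.p₂∘universal))

  dom-⨾ : ∀ {T} {f g : T ⇒ C₁} {p : cod ∘ f ≈ dom ∘ g} → dom ∘ (f ⨾ g [ p ]) ≈ dom ∘ f
  dom-⨾ = Equiv.trans (extendʳ dom-comp) (∘-respʳ C₂.p₁∘universal)

  cod-⨾ : ∀ {T} {f g : T ⇒ C₁} {p : cod ∘ f ≈ dom ∘ g} → cod ∘ (f ⨾ g [ p ]) ≈ cod ∘ g
  cod-⨾ = Equiv.trans (extendʳ cod-comp) (∘-respʳ C₂.p₂∘universal)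

  ⨾-identityˡ : ∀ {T} {X : T ⇒ C₀} {f : T ⇒ C₁} {p : cod ∘ (ε ∘ X) ≈ dom ∘ f} →
                (ε ∘ X) ⨾ f [ p ] ≈ f
  ⨾-identityˡ {X = X} {f} {p} = begin
    (ε ∘ X) ⨾ f [ p ]                 ≈⟨ comp∘
        (Equiv.trans (pullˡ C₂.p₁∘universal) (Equiv.trans assoc (∘-respʳ dom-f)))
        (Equiv.trans (pullˡ C₂.p₂∘universal) identityˡ) ⟨
    comp ∘ (C₂.universal _ _ cod-ε∘dom ∘ f) ≈⟨ pullˡ comp-identityˡ ⟩
    id ∘ f                            ≈⟨ identityˡ ⟩
    f                                 ∎
    where
      open HomReasoning
      dom-f : dom ∘ f ≈ X
      dom-f = Equiv.trans (Equiv.sym p) (Equiv.trans (pullˡ cod-ε) identityˡ)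

  ⨾-identityʳ : ∀ {T} {Y : T ⇒ C₀} {f : T ⇒ C₁} {p : cod ∘ f ≈ dom ∘ (ε ∘ Y)} →
                f ⨾ (ε ∘ Y) [ p ] ≈ f
  ⨾-identityʳ {Y = Y} {f} {p} = begin
    f ⨾ (ε ∘ Y) [ p ]                 ≈⟨ comp∘
        (Equiv.trans (pullˡ C₂.p₁∘universal) identityˡ)
        (Equiv.trans (pullˡ C₂.p₂∘universal) (Equiv.trans assoc (∘-respʳ cod-f))) ⟨
    comp ∘ (C₂.universal _ _ dom-ε∘cod ∘ f) ≈⟨ pullˡ comp-identityʳ ⟩
    id ∘ f                            ≈⟨ identityˡ ⟩
    f                                 ∎
    where
      open HomReasoning
      cod-f : cod ∘ f ≈ Y
      cod-f = Equiv.trans p (Equiv.trans (pullˡ dom-ε) identityˡ)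

  ⨾-assoc : ∀ {T} {f g h : T ⇒ C₁} {p : cod ∘ f ≈ dom ∘ g} {q : cod ∘ g ≈ dom ∘ h}
            {p′ : cod ∘ (f ⨾ g [ p ]) ≈ dom ∘ h} {q′ : cod ∘ f ≈ dom ∘ (g ⨾ h [ q ])} →
            (f ⨾ g [ p ]) ⨾ h [ p′ ] ≈ f ⨾ (g ⨾ h [ q ]) [ q′ ]
  ⨾-assoc {T} {f} {g} {h} {p} {q} {p′} {q′} = begin
    (f ⨾ g [ p ]) ⨾ h [ p′ ]          ≈⟨ comp∘
        (Equiv.trans (pullˡ C₂.p₁∘universal) (Equiv.trans assoc (∘-respʳ C₃.p₁∘universal)))
        (Equiv.trans (pullˡ C₂.p₂∘universal)
          (Equiv.trans assoc (Equiv.trans (∘-respʳ C₃.p₂∘universal) C₂.p₂∘universal))) ⟨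
    comp ∘ (C₂.universal _ _ assoc-eqˡ ∘ t) ≈⟨ pullˡ comp-assoc ⟩
    (comp ∘ C₂.universal _ _ assoc-eqʳ) ∘ t ≈⟨ assoc ⟩
    comp ∘ (C₂.universal _ _ assoc-eqʳ ∘ t) ≈⟨ comp∘
        (Equiv.trans (pullˡ C₂.p₁∘universal)
          (Equiv.trans assoc (Equiv.trans (∘-respʳ C₃.p₁∘universal) C₂.p₁∘universal)))
        (Equiv.trans (pullˡ C₂.p₂∘universal) (Equiv.trans assoc (∘-respʳ C₃.p₂∘universal))) ⟩
    f ⨾ (g ⨾ h [ q ]) [ q′ ]          ∎
    where
      open HomReasoning
      t : T ⇒ C₃.P
      t = C₃.universal (C₂.universal f g p) (C₂.universal g h q)
            (Equiv.trans C₂.p₂∘universal (Equiv.sym C₂.p₁∘universal))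

  ⨾-whisker : ∀ {T} {h f g f′ g′ : T ⇒ C₁}
              {p : cod ∘ h ≈ dom ∘ f} {q : cod ∘ (h ⨾ f [ p ]) ≈ dom ∘ g} {r : cod ∘ f ≈ dom ∘ g}
              {p′ : cod ∘ h ≈ dom ∘ f′} {q′ : cod ∘ (h ⨾ f′ [ p′ ]) ≈ dom ∘ g′}
              {r′ : cod ∘ f′ ≈ dom ∘ g′} →
              f ⨾ g [ r ] ≈ f′ ⨾ g′ [ r′ ] →
              (h ⨾ f [ p ]) ⨾ g [ q ] ≈ (h ⨾ f′ [ p′ ]) ⨾ g′ [ q′ ]
  ⨾-whisker {p = p} {p′ = p′} eq = Equiv.trans (⨾-assoc {q′ = Equiv.trans p (Equiv.sym dom-⨾)})
    (Equiv.trans (⨾-resp Equiv.refl eq)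
      (Equiv.sym (⨾-assoc {q′ = Equiv.trans p′ (Equiv.sym dom-⨾)})))
{-# INLINE InternalCategory.constructor #-}

-- An internal choice of a terminal object and of pullbacks.
record InternalFiniteLimits {o ℓ e} {𝓑 : Category o ℓ e} (L : FiniteLimits 𝓑)
       (ℂ : InternalCategory 𝓑) : Set (o ⊔ ℓ ⊔ e) where
  no-eta-equality
  open Category 𝓑
  open FiniteLimits L
  open InternalCategory ℂ
  field
    ⊤ᶜ           : ⊤ ⇒ C₀
    bang         : C₀ ⇒ C₁
    dom-bang     : dom ∘ bang ≈ id
    cod-bang     : cod ∘ bang ≈ ⊤ᶜ ∘ !
    -- the object of arrows with codomain ⊤ᶜ
    overTerminal : Pullback 𝓑 cod ⊤ᶜ
    bang-unique  : bang ∘ (dom ∘ Pullback.p₁ overTerminal) ≈ Pullback.p₁ overTerminal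

    cospan       : Pullback 𝓑 cod cod

  module Cospan = Pullback cospan

  field
    apex       : Cospan.P ⇒ C₀
    pb₁ pb₂    : Cospan.P ⇒ C₁
    dom-pb₁    : dom ∘ pb₁ ≈ apex
    dom-pb₂    : dom ∘ pb₂ ≈ apex
    cod-pb₁    : cod ∘ pb₁ ≈ dom ∘ Cospan.p₁
    cod-pb₂    : cod ∘ pb₂ ≈ dom ∘ Cospan.p₂
    pb-commute : pb₁ ⨾ Cospan.p₁ [ cod-pb₁ ] ≈ pb₂ ⨾ Cospan.p₂ [ cod-pb₂ ]

    -- the object of internal commutative squares a ⨾ f = b ⨾ g, given as
    -- pairs of composable pairs ((a , f) , (b , g)) with equal composites
    square     : Pullback 𝓑 comp comp

  module Square = Pullback square

  base-eq : cod ∘ (C₂.p₂ ∘ Square.p₁) ≈ cod ∘ (C₂.p₂ ∘ Square.p₂)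
  base-eq = Equiv.trans (Equiv.sym (extendʳ cod-comp))
    (Equiv.trans (∘-respʳ Square.commute) (extendʳ cod-comp))

  base : Square.P ⇒ Cospan.P
  base = Cospan.universal (C₂.p₂ ∘ Square.p₁) (C₂.p₂ ∘ Square.p₂) base-eq

  field
    med     : Square.P ⇒ C₁
    cod-med : cod ∘ med ≈ apex ∘ base

  into-eq₁ : ∀ {T} {h : T ⇒ C₁} {k : T ⇒ Cospan.P} →
             cod ∘ h ≈ apex ∘ k → cod ∘ h ≈ dom ∘ (pb₁ ∘ k)
  into-eq₁ p = Equiv.trans p (Equiv.sym (pullˡ dom-pb₁))

  into-eq₂ : ∀ {T} {h : T ⇒ C₁} {k : T ⇒ Cospan.P} →
             cod ∘ h ≈ apex ∘ k → cod ∘ h ≈ dom ∘ (pb₂ ∘ k)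
  into-eq₂ p = Equiv.trans p (Equiv.sym (pullˡ dom-pb₂))

  field
    med-pb₁ : med ⨾ (pb₁ ∘ base) [ into-eq₁ cod-med ] ≈ C₂.p₁ ∘ Square.p₁
    med-pb₂ : med ⨾ (pb₂ ∘ base) [ into-eq₂ cod-med ] ≈ C₂.p₁ ∘ Square.p₂

    -- the object of internal cospans together with an arrow h into the apex
    into    : Pullback 𝓑 cod apex

  module Into = Pullback into

  cone₁ : ∀ {T} {h : T ⇒ C₁} {k : T ⇒ Cospan.P} → cod ∘ h ≈ apex ∘ k → T ⇒ C₁
  cone₁ {h = h} {k} p = h ⨾ (pb₁ ∘ k) [ into-eq₁ p ]

  cone₂ : ∀ {T} {h : T ⇒ C₁} {k : T ⇒ Cospan.P} → cod ∘ h ≈ apex ∘ k → T ⇒ C₁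
  cone₂ {h = h} {k} p = h ⨾ (pb₂ ∘ k) [ into-eq₂ p ]

  cone₁-eq : ∀ {T} {h : T ⇒ C₁} {k : T ⇒ Cospan.P} (p : cod ∘ h ≈ apex ∘ k) →
             cod ∘ cone₁ p ≈ dom ∘ (Cospan.p₁ ∘ k)
  cone₁-eq p = Equiv.trans cod-⨾ (extendʳ cod-pb₁)

  cone₂-eq : ∀ {T} {h : T ⇒ C₁} {k : T ⇒ Cospan.P} (p : cod ∘ h ≈ apex ∘ k) →
             cod ∘ cone₂ p ≈ dom ∘ (Cospan.p₂ ∘ k)
  cone₂-eq p = Equiv.trans cod-⨾ (extendʳ cod-pb₂)

  cone-commute : ∀ {T} {h : T ⇒ C₁} {k : T ⇒ Cospan.P} (p : cod ∘ h ≈ apex ∘ k) →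
                 cone₁ p ⨾ (Cospan.p₁ ∘ k) [ cone₁-eq p ] ≈
                 cone₂ p ⨾ (Cospan.p₂ ∘ k) [ cone₂-eq p ]
  cone-commute p = ⨾-whisker
    (Equiv.trans (Equiv.sym (⨾-∘ {p′ = extendʳ cod-pb₁}))
      (Equiv.trans (∘-respˡ pb-commute) (⨾-∘ {p′ = extendʳ cod-pb₂})))

  -- the commutative square obtained by composing h with the pullback cone
  coneSquare : ∀ {T} {h : T ⇒ C₁} {k : T ⇒ Cospan.P} → cod ∘ h ≈ apex ∘ k → T ⇒ Square.P
  coneSquare {k = k} p =
    Square.universal (C₂.universal (cone₁ p) (Cospan.p₁ ∘ k) (cone₁-eq p))
                     (C₂.universal (cone₂ p) (Cospan.p₂ ∘ k) (cone₂-eq p)) (cone-commute p)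

  field
    med-unique : med ∘ coneSquare Into.commute ≈ Into.p₁
{-# INLINE InternalFiniteLimits.constructor #-}

module InternalLimitProperties {o ℓ e} {𝓑 : Category o ℓ e} {L : FiniteLimits 𝓑}
       {ℂ : InternalCategory 𝓑} (M : InternalFiniteLimits L ℂ) where
  open Category 𝓑
  open FiniteLimits L
  open InternalCategory ℂ
  open InternalFiniteLimits M

  bang-η : ∀ {T} {h : T ⇒ C₁} → cod ∘ h ≈ ⊤ᶜ ∘ ! → bang ∘ (dom ∘ h) ≈ h
  bang-η {T} {h} p = begin
    bang ∘ (dom ∘ h)               ≈⟨ ∘-respʳ (∘-respʳ over.p₁∘universal) ⟨
    bang ∘ (dom ∘ (over.p₁ ∘ t))   ≈⟨ ∘-respʳ sym-assoc ⟩
    bang ∘ ((dom ∘ over.p₁) ∘ t)   ≈⟨ pullˡ bang-unique ⟩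
    over.p₁ ∘ t                    ≈⟨ over.p₁∘universal ⟩
    h                              ∎
    where
      open HomReasoning
      module over = Pullback overTerminal
      t : T ⇒ over.P
      t = over.universal h ! p

  into-top-unique : ∀ {T} {h k : T ⇒ C₁} → dom ∘ h ≈ dom ∘ k →
                    cod ∘ h ≈ ⊤ᶜ ∘ ! → cod ∘ k ≈ ⊤ᶜ ∘ ! → h ≈ k
  into-top-unique d p q = Equiv.trans (Equiv.sym (bang-η p))
    (Equiv.trans (∘-respʳ d) (bang-η q))

  cospan⟨_,_⟩[_] : ∀ {T} (f g : T ⇒ C₁) → cod ∘ f ≈ cod ∘ g → T ⇒ Cospan.P
  cospan⟨ f , g ⟩[ p ] = Cospan.universal f g p

  coneSquare-resp : ∀ {T} {h h′ : T ⇒ C₁} {k : T ⇒ Cospan.P}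
                    (p : cod ∘ h ≈ apex ∘ k) (p′ : cod ∘ h′ ≈ apex ∘ k) →
                    cone₁ p ≈ cone₁ p′ → cone₂ p ≈ cone₂ p′ → coneSquare p ≈ coneSquare p′
  coneSquare-resp p p′ e₁ e₂ = Square.unique
    (Equiv.trans Square.p₁∘universal
      (Equiv.trans (C₂.unique
        (Equiv.trans C₂.p₁∘universal (Equiv.trans e₁ (Equiv.sym C₂.p₁∘universal)))
        (Equiv.trans C₂.p₂∘universal (Equiv.sym C₂.p₂∘universal)))
        (Equiv.sym Square.p₁∘universal)))
    (Equiv.trans Square.p₂∘universal
      (Equiv.trans (C₂.unique
        (Equiv.trans C₂.p₁∘universal (Equiv.trans e₂ (Equiv.sym C₂.p₁∘universal)))
        (Equiv.trans C₂.p₂∘universal (Equiv.sym C₂.p₂∘universal)))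
        (Equiv.sym Square.p₂∘universal)))

  med-η : ∀ {T} {h : T ⇒ C₁} {k : T ⇒ Cospan.P} (p : cod ∘ h ≈ apex ∘ k) →
          med ∘ coneSquare p ≈ h
  med-η {T} {h} {k} p = begin
    med ∘ coneSquare p                      ≈⟨ ∘-respʳ same ⟨
    med ∘ (coneSquare Into.commute ∘ t)     ≈⟨ pullˡ med-unique ⟩
    Into.p₁ ∘ t                             ≈⟨ Into.p₁∘universal ⟩
    h                                       ∎
    where
      open HomReasoning
      t : T ⇒ Into.P
      t = Into.universal h k p
      c₁ : cone₁ Into.commute ∘ t ≈ cone₁ p
      c₁ = Equiv.trans (⨾-∘ {p′ = Equiv.trans (pullˡ (into-eq₁ Into.commute)) assoc})
             (⨾-resp Into.p₁∘universal (Equiv.trans assoc (∘-respʳ Into.p₂∘universal)))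
      c₂ : cone₂ Into.commute ∘ t ≈ cone₂ p
      c₂ = Equiv.trans (⨾-∘ {p′ = Equiv.trans (pullˡ (into-eq₂ Into.commute)) assoc})
             (⨾-resp Into.p₁∘universal (Equiv.trans assoc (∘-respʳ Into.p₂∘universal)))
      same : coneSquare Into.commute ∘ t ≈ coneSquare p
      same = Square.unique
        (Equiv.trans (pullˡ Square.p₁∘universal) (Equiv.trans (C₂.unique
          (Equiv.trans (pullˡ C₂.p₁∘universal) (Equiv.trans c₁ (Equiv.sym C₂.p₁∘universal)))
          (Equiv.trans (pullˡ C₂.p₂∘universal) (Equiv.trans assoc
            (Equiv.trans (∘-respʳ Into.p₂∘universal) (Equiv.sym C₂.p₂∘universal)))))
          (Equiv.sym Square.p₁∘universal)))
        (Equiv.trans (pullˡ Square.p₂∘universal) (Equiv.trans (C₂.unique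
          (Equiv.trans (pullˡ C₂.p₁∘universal) (Equiv.trans c₂ (Equiv.sym C₂.p₁∘universal)))
          (Equiv.trans (pullˡ C₂.p₂∘universal) (Equiv.trans assoc
            (Equiv.trans (∘-respʳ Into.p₂∘universal) (Equiv.sym C₂.p₂∘universal)))))
          (Equiv.sym Square.p₂∘universal)))

  cone₁-resp : ∀ {T} {h h′ : T ⇒ C₁} {k k′ : T ⇒ Cospan.P}
               (p : cod ∘ h ≈ apex ∘ k) (p′ : cod ∘ h′ ≈ apex ∘ k′) →
               h ≈ h′ → k ≈ k′ → cone₁ p ≈ cone₁ p′
  cone₁-resp p p′ a b = ⨾-resp a (∘-respʳ b)

  cone₂-resp : ∀ {T} {h h′ : T ⇒ C₁} {k k′ : T ⇒ Cospan.P}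
               (p : cod ∘ h ≈ apex ∘ k) (p′ : cod ∘ h′ ≈ apex ∘ k′) →
               h ≈ h′ → k ≈ k′ → cone₂ p ≈ cone₂ p′
  cone₂-resp p p′ a b = ⨾-resp a (∘-respʳ b)

  med-unique₂ : ∀ {T} {h h′ : T ⇒ C₁} {k : T ⇒ Cospan.P}
                (p : cod ∘ h ≈ apex ∘ k) (p′ : cod ∘ h′ ≈ apex ∘ k) →
                cone₁ p ≈ cone₁ p′ → cone₂ p ≈ cone₂ p′ → h ≈ h′
  med-unique₂ p p′ e₁ e₂ = Equiv.trans (Equiv.sym (med-η p))
    (Equiv.trans (∘-respʳ (coneSquare-resp p p′ e₁ e₂)) (med-η p′))

  -- the mediating arrow of the square a ⨾ f ≈ b ⨾ g
  module Mediate {T} (f g a b : T ⇒ C₁) (c : cod ∘ f ≈ cod ∘ g)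
         (p : cod ∘ a ≈ dom ∘ f) (q : cod ∘ b ≈ dom ∘ g)
         (r : a ⨾ f [ p ] ≈ b ⨾ g [ q ]) where

    sq : T ⇒ Square.P
    sq = Square.universal (C₂.universal a f p) (C₂.universal b g q) r

    mediate : T ⇒ C₁
    mediate = med ∘ sq

    base-sq : base ∘ sq ≈ cospan⟨ f , g ⟩[ c ]
    base-sq = Cospan.unique
      (Equiv.trans (pullˡ Cospan.p₁∘universal) (Equiv.trans assoc
        (Equiv.trans (∘-respʳ Square.p₁∘universal)
          (Equiv.trans C₂.p₂∘universal (Equiv.sym Cospan.p₁∘universal)))))
      (Equiv.trans (pullˡ Cospan.p₂∘universal) (Equiv.trans assoc
        (Equiv.trans (∘-respʳ Square.p₂∘universal)
          (Equiv.trans C₂.p₂∘universal (Equiv.sym Cospan.p₂∘universal)))))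

    cod-mediate : cod ∘ mediate ≈ apex ∘ cospan⟨ f , g ⟩[ c ]
    cod-mediate = Equiv.trans (extendʳ cod-med) (∘-respʳ base-sq)

    mediate-pb₁ : ∀ {s} → mediate ⨾ (pb₁ ∘ cospan⟨ f , g ⟩[ c ]) [ s ] ≈ a
    mediate-pb₁ {s} = begin
      mediate ⨾ (pb₁ ∘ cospan⟨ f , g ⟩[ c ]) [ s ]
        ≈⟨ ⨾-resp Equiv.refl (Equiv.trans assoc (∘-respʳ base-sq)) ⟨
      (med ∘ sq) ⨾ ((pb₁ ∘ base) ∘ sq) [ Equiv.trans (pullˡ (into-eq₁ cod-med)) assoc ]
        ≈⟨ ⨾-∘ ⟨
      (med ⨾ (pb₁ ∘ base) [ into-eq₁ cod-med ]) ∘ sq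
        ≈⟨ ∘-respˡ med-pb₁ ⟩
      (C₂.p₁ ∘ Square.p₁) ∘ sq   ≈⟨ Equiv.trans assoc (∘-respʳ Square.p₁∘universal) ⟩
      C₂.p₁ ∘ C₂.universal a f p ≈⟨ C₂.p₁∘universal ⟩
      a                          ∎
      where open HomReasoning

    mediate-pb₂ : ∀ {s} → mediate ⨾ (pb₂ ∘ cospan⟨ f , g ⟩[ c ]) [ s ] ≈ b
    mediate-pb₂ {s} = begin
      mediate ⨾ (pb₂ ∘ cospan⟨ f , g ⟩[ c ]) [ s ]
        ≈⟨ ⨾-resp Equiv.refl (Equiv.trans assoc (∘-respʳ base-sq)) ⟨
      (med ∘ sq) ⨾ ((pb₂ ∘ base) ∘ sq) [ Equiv.trans (pullˡ (into-eq₂ cod-med)) assoc ]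
        ≈⟨ ⨾-∘ ⟨
      (med ⨾ (pb₂ ∘ base) [ into-eq₂ cod-med ]) ∘ sq
        ≈⟨ ∘-respˡ med-pb₂ ⟩
      (C₂.p₁ ∘ Square.p₂) ∘ sq   ≈⟨ Equiv.trans assoc (∘-respʳ Square.p₂∘universal) ⟩
      C₂.p₁ ∘ C₂.universal b g q ≈⟨ C₂.p₁∘universal ⟩
      b                          ∎
      where open HomReasoning

    dom-mediate : dom ∘ mediate ≈ dom ∘ a
    dom-mediate = Equiv.trans (Equiv.sym dom-⨾)
      (∘-respʳ (mediate-pb₁ {into-eq₁ cod-mediate}))

module _ {o ℓ e} {𝓑 : Category o ℓ e} (L : FiniteLimits 𝓑) (ℂ : InternalCategory 𝓑) where
  open Category 𝓑
  open FiniteLimits L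
  open InternalCategory ℂ

  record GlobalArrow (X Y : ⊤ ⇒ C₀) : Set (ℓ ⊔ e) where
    no-eta-equality
    field
      arr     : ⊤ ⇒ C₁
      dom-arr : dom ∘ arr ≈ X
      cod-arr : cod ∘ arr ≈ Y
  {-# INLINE GlobalArrow.constructor #-}

  open GlobalArrow

  -- Equality of objects of Γ is _≈_ on ⊤ ⇒ C₀.
  Γ : Category ℓ (ℓ ⊔ e) e
  Γ = record
    { Obj       = ⊤ ⇒ C₀
    ; _⇒_       = GlobalArrow
    ; _≈_       = λ f g → arr f ≈ arr g
    ; id        = λ {X} → record
      { arr     = ε ∘ X
      ; dom-arr = Equiv.trans (pullˡ dom-ε) identityˡ
      ; cod-arr = Equiv.trans (pullˡ cod-ε) identityˡ
      }
    ; _∘_       = λ g f → record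
      { arr     = arr f ⨾ arr g [ Equiv.trans (cod-arr f) (Equiv.sym (dom-arr g)) ]
      ; dom-arr = Equiv.trans dom-⨾ (dom-arr f)
      ; cod-arr = Equiv.trans cod-⨾ (cod-arr g)
      }
    ; assoc     = Equiv.sym ⨾-assoc
    ; identityˡ = ⨾-identityʳ
    ; identityʳ = ⨾-identityˡ
    ; equiv     = record { refl = Equiv.refl ; sym = Equiv.sym ; trans = Equiv.trans }
    ; ∘-resp-≈  = λ p q → ⨾-resp q p
    }

  module _ (M : InternalFiniteLimits L ℂ) where
    open InternalFiniteLimits M
    open InternalLimitProperties M

    Γ-cospan : ∀ {X Y Z} → GlobalArrow X Z → GlobalArrow Y Z → ⊤ ⇒ Cospan.P
    Γ-cospan f g = cospan⟨ arr f , arr g ⟩[ Equiv.trans (cod-arr f) (Equiv.sym (cod-arr g)) ]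

    Γ-pullback : ∀ {X Y Z} (f : GlobalArrow X Z) (g : GlobalArrow Y Z) → Pullback Γ f g
    Γ-pullback {X} {Y} f g = record
      { P          = apex ∘ c
      ; p₁         = record
        { arr     = pb₁ ∘ c
        ; dom-arr = pullˡ dom-pb₁
        ; cod-arr = Equiv.trans (extendʳ cod-pb₁)
                      (Equiv.trans (∘-respʳ Cospan.p₁∘universal) (dom-arr f))
        }
      ; p₂         = record
        { arr     = pb₂ ∘ c
        ; dom-arr = pullˡ dom-pb₂
        ; cod-arr = Equiv.trans (extendʳ cod-pb₂)
                      (Equiv.trans (∘-respʳ Cospan.p₂∘universal) (dom-arr g))
        }
      ; isPullback = record
        { commute      = Equiv.trans
            (⨾-resp {p′ = extendʳ cod-pb₁} Equiv.refl (Equiv.sym Cospan.p₁∘universal))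
            (Equiv.trans (Equiv.sym ⨾-∘) (Equiv.trans (∘-respˡ pb-commute)
              (Equiv.trans (⨾-∘ {p′ = extendʳ cod-pb₂})
                (⨾-resp Equiv.refl Cospan.p₂∘universal))))
        ; universal    = λ a b r → record
            { arr     = Me.mediate a b r
            ; dom-arr = Equiv.trans (Me.dom-mediate a b r) (dom-arr a)
            ; cod-arr = Me.cod-mediate a b r
            }
        ; p₁∘universal = λ {_} {a} {b} {r} → Me.mediate-pb₁ a b r
        ; p₂∘universal = λ {_} {a} {b} {r} → Me.mediate-pb₂ a b r
        ; unique       = λ {_} {u} {v} r s → med-unique₂ (cod-arr u) (cod-arr v)
            (Equiv.trans (⨾-resp Equiv.refl Equiv.refl)
              (Equiv.trans r (⨾-resp Equiv.refl Equiv.refl)))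
            (Equiv.trans (⨾-resp Equiv.refl Equiv.refl)
              (Equiv.trans s (⨾-resp Equiv.refl Equiv.refl)))
        }
      }
      where
        c = Γ-cospan f g
        module Me {W} (a : GlobalArrow W X) (b : GlobalArrow W Y)
                  (r : Category._≈_ Γ (Category._∘_ Γ f a) (Category._∘_ Γ g b)) =
          Mediate (arr f) (arr g) (arr a) (arr b)
            (Equiv.trans (cod-arr f) (Equiv.sym (cod-arr g)))
            (Equiv.trans (cod-arr a) (Equiv.sym (dom-arr f)))
            (Equiv.trans (cod-arr b) (Equiv.sym (dom-arr g))) r

    cod-arr-⊤ : ∀ {X} (f : GlobalArrow X ⊤ᶜ) → cod ∘ arr f ≈ ⊤ᶜ ∘ !
    cod-arr-⊤ f = Equiv.trans (cod-arr f)
      (Equiv.trans (Equiv.sym identityʳ) (∘-respʳ !-unique₂))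

    Γ-limits : FiniteLimits Γ
    Γ-limits = record
      { ⊤          = ⊤ᶜ
      ; ⊤-terminal = record
        { !        = λ {X} → record
          { arr     = bang ∘ X
          ; dom-arr = Equiv.trans (pullˡ dom-bang) identityˡ
          ; cod-arr = Equiv.trans (extendʳ cod-bang)
                        (Equiv.trans (∘-respʳ !-unique₂) identityʳ)
          }
        ; !-unique = λ {X} f → Equiv.trans (∘-respʳ (Equiv.sym (dom-arr f)))
                       (bang-η (cod-arr-⊤ f))
        }
      ; pullback   = Γ-pullback
      }

  endpoints : C₁ ⇒ C₀ ×̂ C₀
  endpoints = ⟨ dom , cod ⟩

  homPullback : (X Y : ⊤ ⇒ C₀) → Pullback 𝓑 endpoints ⟨ X , Y ⟩
  homPullback X Y = pullback endpoints ⟨ X , Y ⟩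

  ℂ[_,_] : ⊤ ⇒ C₀ → ⊤ ⇒ C₀ → Obj
  ℂ[ X , Y ] = Pullback.P (homPullback X Y)

  incl : ∀ {X Y} → ℂ[ X , Y ] ⇒ C₁
  incl {X} {Y} = Pullback.p₁ (homPullback X Y)

  module _ {X Y : ⊤ ⇒ C₀} where
    private module H = Pullback (homPullback X Y)

    dom-incl : dom ∘ incl {X} {Y} ≈ X ∘ !
    dom-incl = begin
      dom ∘ H.p₁               ≈⟨ pullˡ π₁-⟨⟩ ⟨
      π₁ ∘ (endpoints ∘ H.p₁)  ≈⟨ ∘-respʳ H.commute ⟩
      π₁ ∘ (⟨ X , Y ⟩ ∘ H.p₂)  ≈⟨ pullˡ π₁-⟨⟩ ⟩
      X ∘ H.p₂                 ≈⟨ ∘-respʳ !-unique₂ ⟩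
      X ∘ !                    ∎
      where open HomReasoning

    cod-incl : cod ∘ incl {X} {Y} ≈ Y ∘ !
    cod-incl = begin
      cod ∘ H.p₁               ≈⟨ pullˡ π₂-⟨⟩ ⟨
      π₂ ∘ (endpoints ∘ H.p₁)  ≈⟨ ∘-respʳ H.commute ⟩
      π₂ ∘ (⟨ X , Y ⟩ ∘ H.p₂)  ≈⟨ pullˡ π₂-⟨⟩ ⟩
      Y ∘ H.p₂                 ≈⟨ ∘-respʳ !-unique₂ ⟩
      Y ∘ !                    ∎
      where open HomReasoning

    hom⟨_⟩[_,_] : ∀ {T} (f : T ⇒ C₁) → dom ∘ f ≈ X ∘ ! → cod ∘ f ≈ Y ∘ ! → T ⇒ ℂ[ X , Y ]
    hom⟨ f ⟩[ p , q ] = H.universal f ! (×-unique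
      (Equiv.trans (pullˡ π₁-⟨⟩) (Equiv.trans p (Equiv.sym (pullˡ π₁-⟨⟩))))
      (Equiv.trans (pullˡ π₂-⟨⟩) (Equiv.trans q (Equiv.sym (pullˡ π₂-⟨⟩)))))

    incl-hom : ∀ {T} {f : T ⇒ C₁} {p : dom ∘ f ≈ X ∘ !} {q : cod ∘ f ≈ Y ∘ !} →
               incl ∘ hom⟨ f ⟩[ p , q ] ≈ f
    incl-hom = H.p₁∘universal

    incl-mono : ∀ {T} {u v : T ⇒ ℂ[ X , Y ]} → incl ∘ u ≈ incl ∘ v → u ≈ v
    incl-mono p = H.unique p !-unique₂

    dom-incl∘ : ∀ {T} {u : T ⇒ ℂ[ X , Y ]} → dom ∘ (incl ∘ u) ≈ X ∘ !
    dom-incl∘ = Equiv.trans (pullˡ dom-incl) (Equiv.trans assoc (∘-respʳ !-unique₂))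

    cod-incl∘ : ∀ {T} {u : T ⇒ ℂ[ X , Y ]} → cod ∘ (incl ∘ u) ≈ Y ∘ !
    cod-incl∘ = Equiv.trans (pullˡ cod-incl) (Equiv.trans assoc (∘-respʳ !-unique₂))

  dom-arr! : ∀ {X Y T} (f : GlobalArrow X Y) → dom ∘ (arr f ∘ ! {T}) ≈ X ∘ !
  dom-arr! f = pullˡ (dom-arr f)

  cod-arr! : ∀ {X Y T} (f : GlobalArrow X Y) → cod ∘ (arr f ∘ ! {T}) ≈ Y ∘ !
  cod-arr! f = pullˡ (cod-arr f)

  postcompose-eq : ∀ {T Y Z} {u : T ⇒ C₁} → cod ∘ u ≈ Y ∘ ! → (g : GlobalArrow Y Z) →
                   cod ∘ u ≈ dom ∘ (arr g ∘ !)
  postcompose-eq p g = Equiv.trans p (Equiv.sym (dom-arr! g))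

  -- Postcomposition with a global arrow. It is opaque for type-checking
  -- speed only; incl-postcompose determines it, since incl is monic.
  opaque
    postcompose : ∀ {X Y Z} → GlobalArrow Y Z → ℂ[ X , Y ] ⇒ ℂ[ X , Z ]
    postcompose g = hom⟨ incl ⨾ (arr g ∘ !) [ postcompose-eq cod-incl g ] ⟩[
      Equiv.trans dom-⨾ dom-incl , Equiv.trans cod-⨾ (cod-arr! g) ]

    incl-postcompose : ∀ {X Y Z} (g : GlobalArrow Y Z) →
      incl ∘ postcompose {X} g ≈ incl ⨾ (arr g ∘ !) [ postcompose-eq cod-incl g ]
    incl-postcompose g = incl-hom

  incl-postcompose∘ : ∀ {X Y Z T} (g : GlobalArrow Y Z) {u : T ⇒ ℂ[ X , Y ]}
                      {p : cod ∘ (incl ∘ u) ≈ dom ∘ (arr g ∘ !)} →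
                      incl ∘ (postcompose g ∘ u) ≈ (incl ∘ u) ⨾ (arr g ∘ !) [ p ]
  incl-postcompose∘ g = Equiv.trans (pullˡ (incl-postcompose g))
    (Equiv.trans (⨾-∘ {p′ = Equiv.trans (pullˡ (postcompose-eq cod-incl g)) assoc})
      (⨾-resp Equiv.refl (Equiv.trans assoc (∘-respʳ !-unique₂))))

  homFunctor : (X : ⊤ ⇒ C₀) → Functor Γ 𝓑
  homFunctor X = record
    { F₀           = λ Y → ℂ[ X , Y ]
    ; F₁           = postcompose
    ; identity     = λ {Y} → incl-mono (Equiv.trans (incl-postcompose _)
        (Equiv.trans (⨾-resp {p′ = id-eq} Equiv.refl assoc)
          (Equiv.trans ⨾-identityʳ (Equiv.sym identityʳ))))
    ; homomorphism = λ {_} {_} {_} {f} {g} → incl-mono (begin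
        incl ∘ postcompose (Category._∘_ Γ g f)
          ≈⟨ incl-postcompose _ ⟩
        incl ⨾ ((arr f ⨾ arr g [ Equiv.trans (cod-arr f) (Equiv.sym (dom-arr g)) ]) ∘ !)
          [ postcompose-eq cod-incl (Category._∘_ Γ g f) ]
          ≈⟨ ⨾-resp Equiv.refl ⨾-∘ ⟩
        incl ⨾ ((arr f ∘ !) ⨾ (arr g ∘ !) [ postcompose-eq (cod-arr! f) g ])
          [ Equiv.trans (postcompose-eq cod-incl f) (Equiv.sym dom-⨾) ]
          ≈⟨ ⨾-assoc ⟨
        (incl ⨾ (arr f ∘ !) [ postcompose-eq cod-incl f ]) ⨾ (arr g ∘ !)
          [ Equiv.trans cod-⨾ (postcompose-eq (cod-arr! f) g) ]
          ≈⟨ ⨾-resp (incl-postcompose f) Equiv.refl ⟨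
        (incl ∘ postcompose f) ⨾ (arr g ∘ !) [ postcompose-eq cod-incl∘ g ]
          ≈⟨ incl-postcompose∘ g ⟨
        incl ∘ (postcompose g ∘ postcompose f) ∎)
    ; F-resp-≈     = λ {_} {_} {f} {g} p → incl-mono (Equiv.trans (incl-postcompose f)
        (Equiv.trans (⨾-resp Equiv.refl (∘-respˡ p)) (Equiv.sym (incl-postcompose g))))
    }
    where
      open HomReasoning
      id-eq : ∀ {Y} → cod ∘ incl {X} {Y} ≈ dom ∘ (ε ∘ (Y ∘ !))
      id-eq = Equiv.trans cod-incl (Equiv.sym (Equiv.trans (pullˡ dom-ε) identityˡ))

  module _ (M : InternalFiniteLimits L ℂ) where
    open InternalFiniteLimits M
    open InternalLimitProperties M

    -- global sections: ℂ(1,-)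
    γ : Functor Γ 𝓑
    γ = homFunctor ⊤ᶜ

    module γ-Pullback {X Y Z} (f : GlobalArrow X Z) (g : GlobalArrow Y Z) where
      private
        module G = Functor γ
        module PB = Pullback (FiniteLimits.pullback (Γ-limits M) f g)

      c : ⊤ ⇒ Cospan.P
      c = Γ-cospan M f g

      c-eq : ∀ {T} → cod ∘ (arr f ∘ ! {T}) ≈ cod ∘ (arr g ∘ !)
      c-eq = Equiv.trans (cod-arr! f) (Equiv.sym (cod-arr! g))

      c! : ∀ {T} → c ∘ ! {T} ≈ cospan⟨ arr f ∘ ! , arr g ∘ ! ⟩[ c-eq ]
      c! = Cospan.unique
        (Equiv.trans (pullˡ Cospan.p₁∘universal) (Equiv.sym Cospan.p₁∘universal))
        (Equiv.trans (pullˡ Cospan.p₂∘universal) (Equiv.sym Cospan.p₂∘universal))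

      cod-apex : ∀ {T} (u : T ⇒ ℂ[ ⊤ᶜ , apex ∘ c ]) → cod ∘ (incl ∘ u) ≈ apex ∘ (c ∘ !)
      cod-apex u = Equiv.trans cod-incl∘ assoc

      incl-p₁ : ∀ {T} (u : T ⇒ ℂ[ ⊤ᶜ , apex ∘ c ]) →
                incl ∘ (G.F₁ PB.p₁ ∘ u) ≈ cone₁ (cod-apex u)
      incl-p₁ u = Equiv.trans
        (incl-postcompose∘ PB.p₁ {u} {postcompose-eq cod-incl∘ PB.p₁})
        (⨾-resp Equiv.refl assoc)

      incl-p₂ : ∀ {T} (u : T ⇒ ℂ[ ⊤ᶜ , apex ∘ c ]) →
                incl ∘ (G.F₁ PB.p₂ ∘ u) ≈ cone₂ (cod-apex u)
      incl-p₂ u = Equiv.trans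
        (incl-postcompose∘ PB.p₂ {u} {postcompose-eq cod-incl∘ PB.p₂})
        (⨾-resp Equiv.refl assoc)

      module _ {T} (h : T ⇒ ℂ[ ⊤ᶜ , X ]) (k : T ⇒ ℂ[ ⊤ᶜ , Y ])
               (r : G.F₁ f ∘ h ≈ G.F₁ g ∘ k) where

        square-eq : (incl ∘ h) ⨾ (arr f ∘ !) [ postcompose-eq cod-incl∘ f ] ≈
                    (incl ∘ k) ⨾ (arr g ∘ !) [ postcompose-eq cod-incl∘ g ]
        square-eq = Equiv.trans (Equiv.sym (incl-postcompose∘ f {h}))
                      (Equiv.trans (∘-respʳ r) (incl-postcompose∘ g {k}))

        private
          module Me = Mediate (arr f ∘ !) (arr g ∘ !) (incl ∘ h) (incl ∘ k) c-eq
            (postcompose-eq cod-incl∘ f) (postcompose-eq cod-incl∘ g) square-eq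

        univ-dom : dom ∘ Me.mediate ≈ ⊤ᶜ ∘ !
        univ-dom = Equiv.trans Me.dom-mediate dom-incl∘

        univ-cod : cod ∘ Me.mediate ≈ (apex ∘ c) ∘ !
        univ-cod = Equiv.trans Me.cod-mediate
          (Equiv.trans (∘-respʳ (Equiv.sym c!)) sym-assoc)

        univ : T ⇒ ℂ[ ⊤ᶜ , apex ∘ c ]
        univ = hom⟨ Me.mediate ⟩[ univ-dom , univ-cod ]

        p₁∘univ : G.F₁ PB.p₁ ∘ univ ≈ h
        p₁∘univ = incl-mono (Equiv.trans (incl-p₁ univ)
          (Equiv.trans (cone₁-resp (cod-apex univ) Me.cod-mediate incl-hom c!) Me.mediate-pb₁))

        p₂∘univ : G.F₁ PB.p₂ ∘ univ ≈ k
        p₂∘univ = incl-mono (Equiv.trans (incl-p₂ univ)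
          (Equiv.trans (cone₂-resp (cod-apex univ) Me.cod-mediate incl-hom c!) Me.mediate-pb₂))

      univ-unique : ∀ {T} {u v : T ⇒ ℂ[ ⊤ᶜ , apex ∘ c ]} →
                    G.F₁ PB.p₁ ∘ u ≈ G.F₁ PB.p₁ ∘ v →
                    G.F₁ PB.p₂ ∘ u ≈ G.F₁ PB.p₂ ∘ v → u ≈ v
      univ-unique {u = u} {v} r s = incl-mono (med-unique₂ (cod-apex u) (cod-apex v)
        (Equiv.trans (Equiv.sym (incl-p₁ u)) (Equiv.trans (∘-respʳ r) (incl-p₁ v)))
        (Equiv.trans (Equiv.sym (incl-p₂ u)) (Equiv.trans (∘-respʳ s) (incl-p₂ v))))

      γ-pullback : IsPullback 𝓑 (G.F₁ PB.p₁) (G.F₁ PB.p₂) (G.F₁ f) (G.F₁ g)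
      γ-pullback = record
        { commute      = G.F-square {f = f} {PB.p₁} {g} {PB.p₂} PB.commute
        ; universal    = univ
        ; p₁∘universal = λ {_} {h} {k} {r} → p₁∘univ h k r
        ; p₂∘universal = λ {_} {h} {k} {r} → p₂∘univ h k r
        ; unique       = univ-unique
        }

    γ-terminal : IsTerminal 𝓑 ℂ[ ⊤ᶜ , ⊤ᶜ ]
    γ-terminal = record
      { !        = hom⟨ ε ∘ (⊤ᶜ ∘ !) ⟩[ Equiv.trans (pullˡ dom-ε) identityˡ
                                      , Equiv.trans (pullˡ cod-ε) identityˡ ]
      ; !-unique = λ f → incl-mono (into-top-unique
          (Equiv.trans dom-incl∘ (Equiv.sym dom-incl∘)) cod-incl∘ cod-incl∘)
      }

    opaque
      γ-preserves : PreservesFiniteLimits γ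
      γ-preserves = preservesChosen⇒preserves (Γ-limits M) γ γ-terminal γ-Pullback.γ-pullback

-- Morphisms whose endpoints are only _≈_-equal are compared as arrows ⊤ ⇒ C₁.
-- Mediating arrows are then preserved too, being unique.
record StrictlyPreservesLimits {o ℓ e} {𝓑 : Category o ℓ e} (L : FiniteLimits 𝓑)
       {ℂ : InternalCategory 𝓑} (M : InternalFiniteLimits L ℂ) (F : Functor 𝓑 (Γ L ℂ))
       : Set (o ⊔ ℓ ⊔ e) where
  no-eta-equality
  open Category 𝓑
  open FiniteLimits L
  open Functor F
  open GlobalArrow
  private module ΓL = FiniteLimits (Γ-limits L ℂ M)
  field
    strict-⊤  : F₀ ⊤ ≈ ΓL.⊤
    strict-P  : ∀ {A B C} (f : A ⇒ C) (g : B ⇒ C) →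
                F₀ (Pullback.P (pullback f g)) ≈ Pullback.P (ΓL.pullback (F₁ f) (F₁ g))
    strict-p₁ : ∀ {A B C} (f : A ⇒ C) (g : B ⇒ C) →
                arr (F₁ (Pullback.p₁ (pullback f g))) ≈
                arr (Pullback.p₁ (ΓL.pullback (F₁ f) (F₁ g)))
    strict-p₂ : ∀ {A B C} (f : A ⇒ C) (g : B ⇒ C) →
                arr (F₁ (Pullback.p₂ (pullback f g))) ≈
                arr (Pullback.p₂ (ΓL.pullback (F₁ f) (F₁ g)))
{-# INLINE StrictlyPreservesLimits.constructor #-}

module _ {o ℓ e} {𝓑 : Category o ℓ e} {L : FiniteLimits 𝓑} {ℂ : InternalCategory 𝓑}
         {M : InternalFiniteLimits L ℂ} {F : Functor 𝓑 (Γ L ℂ)}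
         (S : StrictlyPreservesLimits L M F) where
  open Category 𝓑
  open FiniteLimits L
  open Functor F
  open GlobalArrow
  open InternalCategory ℂ using (⨾-resp)
  open StrictlyPreservesLimits S
  private
    module ΓC = Category (Γ L ℂ)
    module ΓL = FiniteLimits (Γ-limits L ℂ M)

    retype : ∀ {X Y Z} → Y ≈ Z → X ΓC.⇒ Y → X ΓC.⇒ Z
    retype p f = record { arr = arr f ; dom-arr = dom-arr f ; cod-arr = Equiv.trans (cod-arr f) p }

    module _ {A B C} (f : A ⇒ C) (g : B ⇒ C) where
      private
        module P = Pullback (pullback f g)
        module Q = Pullback (ΓL.pullback (F₁ f) (F₁ g))

        swap₁ : ∀ {W} (u : W ΓC.⇒ F₀ P.P) (v : W ΓC.⇒ Q.P) → arr u ≈ arr v →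
                arr (F₁ P.p₁ ΓC.∘ u) ≈ arr (Q.p₁ ΓC.∘ v)
        swap₁ u v p = ⨾-resp p (strict-p₁ f g)

        swap₂ : ∀ {W} (u : W ΓC.⇒ F₀ P.P) (v : W ΓC.⇒ Q.P) → arr u ≈ arr v →
                arr (F₁ P.p₂ ΓC.∘ u) ≈ arr (Q.p₂ ΓC.∘ v)
        swap₂ u v p = ⨾-resp p (strict-p₂ f g)

        fwd : ∀ {W} → W ΓC.⇒ F₀ P.P → W ΓC.⇒ Q.P
        fwd = retype (strict-P f g)

        bwd : ∀ {W} → W ΓC.⇒ Q.P → W ΓC.⇒ F₀ P.P
        bwd = retype (Equiv.sym (strict-P f g))

      F-pullback : IsPullback (Γ L ℂ) (F₁ P.p₁) (F₁ P.p₂) (F₁ f) (F₁ g)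
      F-pullback = record
        { commute      = F-square P.commute
        ; universal    = λ h k r → bwd (Q.universal h k r)
        ; p₁∘universal = λ {_} {h} {k} {r} → Equiv.trans
            (swap₁ (bwd (Q.universal h k r)) (Q.universal h k r) Equiv.refl)
            (Q.p₁∘universal {h = h} {k} {r})
        ; p₂∘universal = λ {_} {h} {k} {r} → Equiv.trans
            (swap₂ (bwd (Q.universal h k r)) (Q.universal h k r) Equiv.refl)
            (Q.p₂∘universal {h = h} {k} {r})
        ; unique       = λ {_} {u} {v} r s → Q.unique {u = fwd u} {fwd v}
            (Equiv.trans (Equiv.sym (swap₁ u (fwd u) Equiv.refl))
              (Equiv.trans r (swap₁ v (fwd v) Equiv.refl)))
            (Equiv.trans (Equiv.sym (swap₂ u (fwd u) Equiv.refl))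
              (Equiv.trans s (swap₂ v (fwd v) Equiv.refl)))
        }

  opaque
    strict⇒preserves : PreservesFiniteLimits F
    strict⇒preserves = preservesChosen⇒preserves L F
      (record
        { !        = retype (Equiv.sym strict-⊤) ΓL.!
        ; !-unique = λ f → ΓL.!-unique (retype strict-⊤ f)
        })
      F-pullback

module _ {o ℓ e o′ ℓ′ e′} {𝓑 : Category o ℓ e} {𝓓 : Category o′ ℓ′ e′}
         (G : Functor 𝓑 𝓓) (pres : PreservesFiniteLimits G) where
  private
    module B = Category 𝓑
    module D = Category 𝓓
  open Functor G
  open PreservesFiniteLimits pres

  private
    F₁-universal : ∀ {A B C T} {f : A B.⇒ C} {g : B B.⇒ C} (p : Pullback 𝓑 f g)
                   {h : T B.⇒ A} {k : T B.⇒ B} {r : f B.∘ h B.≈ g B.∘ k}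
                   {h′ : F₀ T D.⇒ F₀ A} {k′ : F₀ T D.⇒ F₀ B}
                   {r′ : F₁ f D.∘ h′ D.≈ F₁ g D.∘ k′} →
                   F₁ h D.≈ h′ → F₁ k D.≈ k′ →
                   F₁ (Pullback.universal p h k r) D.≈ Pullback.universal (mapPullback p) h′ k′ r′
    F₁-universal p a b = Pullback.unique (mapPullback p)
      (D.Equiv.trans (F-triangle (Pullback.p₁∘universal p))
        (D.Equiv.trans a (D.Equiv.sym (Pullback.p₁∘universal (mapPullback p)))))
      (D.Equiv.trans (F-triangle (Pullback.p₂∘universal p))
        (D.Equiv.trans b (D.Equiv.sym (Pullback.p₂∘universal (mapPullback p)))))

    F-id : ∀ {A B} {f : B B.⇒ A} {g : A B.⇒ B} → f B.∘ g B.≈ B.id → F₁ f D.∘ F₁ g D.≈ D.id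
    F-id p = D.Equiv.trans (F-triangle p) identity

  mapCategory : InternalCategory 𝓑 → InternalCategory 𝓓
  mapCategory ℂ = record
    { C₀             = F₀ C₀
    ; C₁             = F₀ C₁
    ; dom            = F₁ dom
    ; cod            = F₁ cod
    ; ε              = F₁ ε
    ; dom-ε          = F-id dom-ε
    ; cod-ε          = F-id cod-ε
    ; composable     = mapPullback composable
    ; comp           = F₁ comp
    ; dom-comp       = F-square dom-comp
    ; cod-comp       = F-square cod-comp
    ; triple         = mapPullback triple
    ; comp-identityˡ = D.Equiv.trans
        (D.∘-respʳ (D.Equiv.sym (F₁-universal composable homomorphism identity)))
        (F-id comp-identityˡ)
    ; comp-identityʳ = D.Equiv.trans
        (D.∘-respʳ (D.Equiv.sym (F₁-universal composable identity homomorphism)))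
        (F-id comp-identityʳ)
    ; comp-assoc     = D.Equiv.trans
        (D.∘-respʳ (D.Equiv.sym (F₁-universal composable homomorphism homomorphism)))
        (D.Equiv.trans (F-square comp-assoc)
          (D.∘-respʳ (F₁-universal composable homomorphism homomorphism)))
    }
    where
      open InternalCategory ℂ

  F₁-⨾ : (ℂ : InternalCategory 𝓑) (let module C = InternalCategory ℂ)
         (let module GC = InternalCategory (mapCategory ℂ)) →
         ∀ {T} {f g : T B.⇒ C.C₁} {p : C.cod B.∘ f B.≈ C.dom B.∘ g}
         {f′ g′ : F₀ T D.⇒ GC.C₁} {p′ : GC.cod D.∘ f′ D.≈ GC.dom D.∘ g′} →
         F₁ f D.≈ f′ → F₁ g D.≈ g′ →
         F₁ (f C.⨾ g [ p ]) D.≈ f′ GC.⨾ g′ [ p′ ]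
  F₁-⨾ ℂ a b = D.Equiv.trans homomorphism
    (D.∘-respʳ (F₁-universal (InternalCategory.composable ℂ) a b))

  module _ (L : FiniteLimits 𝓑) (L′ : FiniteLimits 𝓓) {ℂ : InternalCategory 𝓑} where
    private
      module L = FiniteLimits L
      module L′ = FiniteLimits L′
      module C = InternalCategory ℂ
      module GC = InternalCategory (mapCategory ℂ)
      u = ⊤⇒G⊤ L L′ pres
      module G⊤ = IsTerminal (G⊤-terminal L L′ pres)

    mapLimits : InternalFiniteLimits L ℂ → InternalFiniteLimits L′ (mapCategory ℂ)
    mapLimits M = record
      { ⊤ᶜ           = F₁ M.⊤ᶜ D.∘ u
      ; bang         = F₁ M.bang
      ; dom-bang     = F-id M.dom-bang
      ; cod-bang     = D.Equiv.trans (F-square M.cod-bang)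
          (D.Equiv.trans (D.∘-respʳ G⊤.!-unique₂) D.sym-assoc)
      ; overTerminal = record
        { p₁         = GO.p₁
        ; p₂         = L′.!
        ; isPullback = record
          { commute      = D.Equiv.trans GO.commute
              (D.Equiv.trans (D.∘-respʳ G⊤.!-unique₂) D.sym-assoc)
          ; universal    = λ h k r → GO.universal h (u D.∘ k) (D.Equiv.trans r D.assoc)
          ; p₁∘universal = GO.p₁∘universal
          ; p₂∘universal = L′.!-unique₂
          ; unique       = λ r _ → GO.unique r G⊤.!-unique₂
          }
        }
      ; bang-unique  = D.Equiv.trans (D.∘-respʳ (D.Equiv.sym homomorphism))
          (F-triangle M.bang-unique)
      ; cospan       = mapPullback M.cospan
      ; apex         = F₁ M.apex
      ; pb₁          = F₁ M.pb₁
      ; pb₂          = F₁ M.pb₂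
      ; dom-pb₁      = F-triangle M.dom-pb₁
      ; dom-pb₂      = F-triangle M.dom-pb₂
      ; cod-pb₁      = F-square M.cod-pb₁
      ; cod-pb₂      = F-square M.cod-pb₂
      ; pb-commute   = Gpb-commute
      ; square       = mapPullback M.square
      ; med          = F₁ M.med
      ; cod-med      = D.Equiv.trans (F-square M.cod-med) (D.∘-respʳ Gbase)
      ; med-pb₁      = Gmed-pb₁
      ; med-pb₂      = Gmed-pb₂
      ; into         = mapPullback M.into
      ; med-unique   = Gmed-unique
          (GSquare.p₁∘universal) (GSquare.p₂∘universal)
      }
      where
        module M = InternalFiniteLimits M
        module GO = Pullback (mapPullback M.overTerminal)
        module GCospan = Pullback (mapPullback M.cospan)
        module GSquare = Pullback (mapPullback M.square)

        Gbase : ∀ {r} → F₁ M.base D.≈ GCospan.universal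
                  (F₁ C.C₂.p₂ D.∘ F₁ M.Square.p₁) (F₁ C.C₂.p₂ D.∘ F₁ M.Square.p₂) r
        Gbase = F₁-universal M.cospan homomorphism homomorphism

        Gpb-commute : ∀ {p q} → F₁ M.pb₁ GC.⨾ F₁ M.Cospan.p₁ [ p ] D.≈
                                F₁ M.pb₂ GC.⨾ F₁ M.Cospan.p₂ [ q ]
        Gpb-commute = D.Equiv.trans (D.Equiv.sym (F₁-⨾ ℂ D.Equiv.refl D.Equiv.refl))
          (D.Equiv.trans (F-resp-≈ M.pb-commute) (F₁-⨾ ℂ D.Equiv.refl D.Equiv.refl))

        Gmed-pb₁ : ∀ {r p} → F₁ M.med GC.⨾ (F₁ M.pb₁ D.∘ GCospan.universal _ _ r) [ p ] D.≈
                             F₁ C.C₂.p₁ D.∘ F₁ M.Square.p₁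
        Gmed-pb₁ = D.Equiv.trans
          (D.Equiv.sym (F₁-⨾ ℂ D.Equiv.refl (D.Equiv.trans homomorphism (D.∘-respʳ Gbase))))
          (D.Equiv.trans (F-resp-≈ M.med-pb₁) homomorphism)

        Gmed-pb₂ : ∀ {r p} → F₁ M.med GC.⨾ (F₁ M.pb₂ D.∘ GCospan.universal _ _ r) [ p ] D.≈
                             F₁ C.C₂.p₁ D.∘ F₁ M.Square.p₂
        Gmed-pb₂ = D.Equiv.trans
          (D.Equiv.sym (F₁-⨾ ℂ D.Equiv.refl (D.Equiv.trans homomorphism (D.∘-respʳ Gbase))))
          (D.Equiv.trans (F-resp-≈ M.med-pb₂) homomorphism)

        Gcone₁ : ∀ {p q} → F₁ (C.C₂.universal (M.cone₁ M.Into.commute)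
                              (M.Cospan.p₁ B.∘ M.Into.p₂) (M.cone₁-eq M.Into.commute)) D.≈
                 GC.C₂.universal (F₁ M.Into.p₁ GC.⨾ (F₁ M.pb₁ D.∘ F₁ M.Into.p₂) [ p ])
                                 (F₁ M.Cospan.p₁ D.∘ F₁ M.Into.p₂) q
        Gcone₁ = F₁-universal C.composable (F₁-⨾ ℂ D.Equiv.refl homomorphism) homomorphism

        Gcone₂ : ∀ {p q} → F₁ (C.C₂.universal (M.cone₂ M.Into.commute)
                              (M.Cospan.p₂ B.∘ M.Into.p₂) (M.cone₂-eq M.Into.commute)) D.≈
                 GC.C₂.universal (F₁ M.Into.p₁ GC.⨾ (F₁ M.pb₂ D.∘ F₁ M.Into.p₂) [ p ])
                                 (F₁ M.Cospan.p₂ D.∘ F₁ M.Into.p₂) q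
        Gcone₂ = F₁-universal C.composable (F₁-⨾ ℂ D.Equiv.refl homomorphism) homomorphism

        Gmed-unique : ∀ {p q p′ q′} {t : F₀ M.Into.P D.⇒ GSquare.P} →
          GSquare.p₁ D.∘ t D.≈
            GC.C₂.universal (F₁ M.Into.p₁ GC.⨾ (F₁ M.pb₁ D.∘ F₁ M.Into.p₂) [ p ])
                            (F₁ M.Cospan.p₁ D.∘ F₁ M.Into.p₂) q →
          GSquare.p₂ D.∘ t D.≈
            GC.C₂.universal (F₁ M.Into.p₁ GC.⨾ (F₁ M.pb₂ D.∘ F₁ M.Into.p₂) [ p′ ])
                            (F₁ M.Cospan.p₂ D.∘ F₁ M.Into.p₂) q′ →
          F₁ M.med D.∘ t D.≈ F₁ M.Into.p₁
        Gmed-unique a b = D.Equiv.trans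
          (D.∘-respʳ (GSquare.unique
            (D.Equiv.trans a (D.Equiv.sym
              (D.Equiv.trans (F-triangle M.Square.p₁∘universal) Gcone₁)))
            (D.Equiv.trans b (D.Equiv.sym
              (D.Equiv.trans (F-triangle M.Square.p₂∘universal) Gcone₂)))))
          (F-triangle M.med-unique)

record InternalFunctor {o ℓ e} {𝓑 : Category o ℓ e} (ℂ 𝔻 : InternalCategory 𝓑)
       : Set (o ⊔ ℓ ⊔ e) where
  no-eta-equality
  open Category 𝓑
  private
    module C = InternalCategory ℂ
    module D = InternalCategory 𝔻
  field
    H₀    : C.C₀ ⇒ D.C₀
    H₁    : C.C₁ ⇒ D.C₁
    dom-H : D.dom ∘ H₁ ≈ H₀ ∘ C.dom
    cod-H : D.cod ∘ H₁ ≈ H₀ ∘ C.cod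
    ε-H   : H₁ ∘ C.ε ≈ D.ε ∘ H₀

  H-eq : ∀ {T} {f g : T ⇒ C.C₁} → C.cod ∘ f ≈ C.dom ∘ g → D.cod ∘ (H₁ ∘ f) ≈ D.dom ∘ (H₁ ∘ g)
  H-eq p = Equiv.trans (extendʳ cod-H) (Equiv.trans (∘-respʳ p) (Equiv.sym (extendʳ dom-H)))

  field
    comp-H : H₁ ∘ C.comp ≈ (H₁ ∘ C.C₂.p₁) D.⨾ (H₁ ∘ C.C₂.p₂) [ H-eq C.C₂.commute ]

  H-⨾ : ∀ {T} {f g : T ⇒ C.C₁} {p : C.cod ∘ f ≈ C.dom ∘ g}
        {q : D.cod ∘ (H₁ ∘ f) ≈ D.dom ∘ (H₁ ∘ g)} →
        H₁ ∘ (f C.⨾ g [ p ]) ≈ (H₁ ∘ f) D.⨾ (H₁ ∘ g) [ q ]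
  H-⨾ {f = f} {g} {p} {q} = Equiv.trans (pullˡ comp-H)
    (Equiv.trans (D.⨾-∘ {p′ = Equiv.trans (pullˡ (H-eq C.C₂.commute)) assoc})
      (D.⨾-resp (Equiv.trans assoc (∘-respʳ C.C₂.p₁∘universal))
                (Equiv.trans assoc (∘-respʳ C.C₂.p₂∘universal))))
{-# INLINE InternalFunctor.constructor #-}

module _ {o ℓ e} {𝓑 : Category o ℓ e} where
  open Category 𝓑

  infixr 9 _∘I_
  infix  4 _≈I_

  _∘I_ : {ℂ 𝔻 𝔼 : InternalCategory 𝓑} →
         InternalFunctor 𝔻 𝔼 → InternalFunctor ℂ 𝔻 → InternalFunctor ℂ 𝔼
  _∘I_ {ℂ} {𝔻} {𝔼} K H = record
    { H₀     = K.H₀ ∘ H.H₀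
    ; H₁     = K.H₁ ∘ H.H₁
    ; dom-H  = Equiv.trans (pullˡ K.dom-H)
                 (Equiv.trans assoc (Equiv.trans (∘-respʳ H.dom-H) sym-assoc))
    ; cod-H  = Equiv.trans (pullˡ K.cod-H)
                 (Equiv.trans assoc (Equiv.trans (∘-respʳ H.cod-H) sym-assoc))
    ; ε-H    = Equiv.trans assoc (Equiv.trans (∘-respʳ H.ε-H)
                 (Equiv.trans (pullˡ K.ε-H) assoc))
    ; comp-H = Equiv.trans assoc (Equiv.trans (∘-respʳ H.comp-H)
                 (Equiv.trans (K.H-⨾ {q = K.H-eq (H.H-eq (InternalCategory.C₂.commute ℂ))})
                   (InternalCategory.⨾-resp 𝔼 sym-assoc sym-assoc)))
    }
    where
      module K = InternalFunctor K
      module H = InternalFunctor H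

  record _≈I_ {ℂ 𝔻 : InternalCategory 𝓑} (H K : InternalFunctor ℂ 𝔻) : Set e where
    field
      ≈₀ : InternalFunctor.H₀ H ≈ InternalFunctor.H₀ K
      ≈₁ : InternalFunctor.H₁ H ≈ InternalFunctor.H₁ K

  -- Preservation of the chosen cones; mediating arrows are then preserved
  -- too, being unique.
  record InternallyStrict {L : FiniteLimits 𝓑} {ℂ 𝔻 : InternalCategory 𝓑}
         (M : InternalFiniteLimits L ℂ) (N : InternalFiniteLimits L 𝔻)
         (H : InternalFunctor ℂ 𝔻) : Set e where
    open InternalFunctor H
    private
      module M = InternalFiniteLimits M
      module N = InternalFiniteLimits N

    H-cospan : M.Cospan.P ⇒ N.Cospan.P
    H-cospan = N.Cospan.universal (H₁ ∘ M.Cospan.p₁) (H₁ ∘ M.Cospan.p₂)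
      (Equiv.trans (extendʳ cod-H)
        (Equiv.trans (∘-respʳ M.Cospan.commute) (Equiv.sym (extendʳ cod-H))))

    field
      H-⊤    : H₀ ∘ M.⊤ᶜ ≈ N.⊤ᶜ
      H-apex : H₀ ∘ M.apex ≈ N.apex ∘ H-cospan
      H-pb₁  : H₁ ∘ M.pb₁ ≈ N.pb₁ ∘ H-cospan
      H-pb₂  : H₁ ∘ M.pb₂ ≈ N.pb₂ ∘ H-cospan

module _ {o ℓ e} {𝓑 : Category o ℓ e} (L : FiniteLimits 𝓑) {ℂ 𝔻 : InternalCategory 𝓑}
         (H : InternalFunctor ℂ 𝔻) where
  open Category 𝓑
  open FiniteLimits L
  open InternalFunctor H
  open GlobalArrow
  private
    module C = InternalCategory ℂ
    module D = InternalCategory 𝔻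

  ΓF : Functor (Γ L ℂ) (Γ L 𝔻)
  ΓF = record
    { F₀           = λ X → H₀ ∘ X
    ; F₁           = λ f → record
      { arr     = H₁ ∘ arr f
      ; dom-arr = Equiv.trans (extendʳ dom-H) (∘-respʳ (dom-arr f))
      ; cod-arr = Equiv.trans (extendʳ cod-H) (∘-respʳ (cod-arr f))
      }
    ; identity     = extendʳ ε-H
    ; homomorphism = H-⨾
    ; F-resp-≈     = ∘-respʳ
    }

  homMap : ∀ X Y → ℂ[_,_] L ℂ X Y ⇒ ℂ[_,_] L 𝔻 (H₀ ∘ X) (H₀ ∘ Y)
  homMap X Y = hom⟨_⟩[_,_] L 𝔻 (H₁ ∘ incl L ℂ)
    (Equiv.trans (extendʳ dom-H) (Equiv.trans (∘-respʳ (dom-incl L ℂ)) sym-assoc))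
    (Equiv.trans (extendʳ cod-H) (Equiv.trans (∘-respʳ (cod-incl L ℂ)) sym-assoc))

-- Equality of functors into Γℂ, whose hom-sets depend on objects that are
-- only _≈_-equal.
record EqualΓ {o ℓ e o′ ℓ′ e′} {𝓐 : Category o′ ℓ′ e′} {𝓑 : Category o ℓ e}
       (L : FiniteLimits 𝓑) (ℂ : InternalCategory 𝓑) (P Q : Functor 𝓐 (Γ L ℂ))
       : Set (o′ ⊔ ℓ′ ⊔ e) where
  private
    module A = Category 𝓐
    module B = Category 𝓑
    module P = Functor P
    module Q = Functor Q
  open GlobalArrow
  field
    on-objects : ∀ A → P.F₀ A B.≈ Q.F₀ A
    on-arrows  : ∀ {A B} (f : A A.⇒ B) → arr (P.F₁ f) B.≈ arr (Q.F₁ f)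

module _ {o ℓ e o′ ℓ′ e′} {𝓑 : Category o ℓ e} {𝓓 : Category o′ ℓ′ e′}
         (G : Functor 𝓑 𝓓) (pres : PreservesFiniteLimits G) where
  private
    module B = Category 𝓑
    module D = Category 𝓓
  open Functor G
  open PreservesFiniteLimits pres

  mapFunctor : {ℂ 𝔻 : InternalCategory 𝓑} → InternalFunctor ℂ 𝔻 →
               InternalFunctor (mapCategory G pres ℂ) (mapCategory G pres 𝔻)
  mapFunctor {ℂ} {𝔻} H = record
    { H₀     = F₁ H₀
    ; H₁     = F₁ H₁
    ; dom-H  = F-square dom-H
    ; cod-H  = F-square cod-H
    ; ε-H    = F-square ε-H
    ; comp-H = D.Equiv.trans (F-triangle comp-H)
                 (F₁-⨾ G pres 𝔻 homomorphism homomorphism)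
    }
    where open InternalFunctor H

  module _ (L : FiniteLimits 𝓑) (L′ : FiniteLimits 𝓓) (ℂ : InternalCategory 𝓑) where
    private
      module L = FiniteLimits L
      module L′ = FiniteLimits L′
      module C = InternalCategory ℂ
      Gℂ = mapCategory G pres ℂ
      module GC = InternalCategory Gℂ
      u = ⊤⇒G⊤ L L′ pres
      module G⊤ = IsTerminal (G⊤-terminal L L′ pres)
    open GlobalArrow

    _♯ : Functor (Γ L ℂ) (Γ L′ Gℂ)
    _♯ = record
      { F₀           = λ X → F₁ X D.∘ u
      ; F₁           = λ f → record
        { arr     = F₁ (arr f) D.∘ u
        ; dom-arr = D.pullˡ (F-triangle (dom-arr f))
        ; cod-arr = D.pullˡ (F-triangle (cod-arr f))
        }
      ; identity     = D.Equiv.trans (D.∘-respˡ homomorphism) D.assoc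
      ; homomorphism = λ {_} {_} {_} {f} {g} → D.Equiv.trans
          (D.∘-respˡ (F₁-⨾ G pres ℂ {p′ = F-square
            (B.Equiv.trans (cod-arr f) (B.Equiv.sym (dom-arr g)))} D.Equiv.refl D.Equiv.refl))
          GC.⨾-∘
      ; F-resp-≈     = λ p → D.∘-respˡ (F-resp-≈ p)
      }

    -- the canonical isomorphism (Gℂ)(G♯X,G♯Y) ≅ G(ℂ(X,Y))
    module _ {X Y : L.⊤ B.⇒ C.C₀} {X′ Y′ : L′.⊤ D.⇒ GC.C₀}
             (p : X′ D.≈ Functor.F₀ _♯ X) (q : Y′ D.≈ Functor.F₀ _♯ Y) where
      private
        module GH = Pullback (mapPullback (homPullback L ℂ X Y))

        endpoint : ∀ {Z Z′ T} → Z′ D.≈ Functor.F₀ _♯ Z → {t : T D.⇒ F₀ L.⊤} →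
                   Z′ D.∘ L′.! D.≈ F₁ Z D.∘ t
        endpoint r = D.Equiv.trans (D.∘-respˡ r)
          (D.Equiv.trans D.assoc (D.∘-respʳ G⊤.!-unique₂))

        to-eq : F₁ (endpoints L ℂ) D.∘ incl L′ Gℂ {X′} {Y′} D.≈
                F₁ L.⟨ X , Y ⟩ D.∘ (u D.∘ L′.!)
        to-eq = G×-unique L L′ pres
          (D.Equiv.trans (D.pullˡ (F-triangle L.π₁-⟨⟩))
            (D.Equiv.trans (dom-incl L′ Gℂ)
              (D.Equiv.trans (endpoint p) (D.Equiv.sym (D.pullˡ (F-triangle L.π₁-⟨⟩))))))
          (D.Equiv.trans (D.pullˡ (F-triangle L.π₂-⟨⟩))
            (D.Equiv.trans (cod-incl L′ Gℂ)
              (D.Equiv.trans (endpoint q) (D.Equiv.sym (D.pullˡ (F-triangle L.π₂-⟨⟩))))))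

      hom≅ : ℂ[_,_] L′ Gℂ X′ Y′ D.≅ F₀ (ℂ[_,_] L ℂ X Y)
      hom≅ = record
        { to   = GH.universal (incl L′ Gℂ) (u D.∘ L′.!) to-eq
        ; from = hom⟨_⟩[_,_] L′ Gℂ (F₁ (incl L ℂ))
            (D.Equiv.trans (F-square (dom-incl L ℂ)) (D.Equiv.sym (endpoint p)))
            (D.Equiv.trans (F-square (cod-incl L ℂ)) (D.Equiv.sym (endpoint q)))
        ; isoˡ = incl-mono L′ Gℂ (D.Equiv.trans (D.pullˡ (incl-hom L′ Gℂ))
            (D.Equiv.trans GH.p₁∘universal (D.Equiv.sym D.identityʳ)))
        ; isoʳ = GH.unique
            (D.Equiv.trans (D.pullˡ GH.p₁∘universal)
              (D.Equiv.trans (incl-hom L′ Gℂ) (D.Equiv.sym D.identityʳ)))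
            G⊤.!-unique₂
        }

      Gincl∘hom≅ : F₁ (incl L ℂ) D.∘ D._≅_.to hom≅ D.≈ incl L′ Gℂ
      Gincl∘hom≅ = GH.p₁∘universal

    Gincl-mono : ∀ {X Y T} {s t : T D.⇒ F₀ (ℂ[_,_] L ℂ X Y)} →
                 F₁ (incl L ℂ) D.∘ s D.≈ F₁ (incl L ℂ) D.∘ t → s D.≈ t
    Gincl-mono {X} {Y} r = Pullback.unique (mapPullback (homPullback L ℂ X Y)) r G⊤.!-unique₂

record PreGeminalCategory (o ℓ e : Level) : Set (lsuc (o ⊔ ℓ ⊔ e)) where
  field
    𝓑        : Category o ℓ e
    𝓑-limits : FiniteLimits 𝓑
    ℂ        : InternalCategory 𝓑
    ℂ-limits : InternalFiniteLimits 𝓑-limits ℂ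
    F        : Functor 𝓑 (Γ 𝓑-limits ℂ)
    F-strict : StrictlyPreservesLimits 𝓑-limits ℂ-limits F

  □ : Functor 𝓑 𝓑
  □ = γ 𝓑-limits ℂ ℂ-limits ∘F F

  □-preserves : PreservesFiniteLimits □
  □-preserves = pres-∘ (γ-preserves 𝓑-limits ℂ ℂ-limits) (strict⇒preserves F-strict)

  □ℂ : InternalCategory 𝓑
  □ℂ = mapCategory □ □-preserves ℂ

  □ℂ-limits : InternalFiniteLimits 𝓑-limits □ℂ
  □ℂ-limits = mapLimits □ □-preserves 𝓑-limits 𝓑-limits ℂ-limits

  □♯ : Functor (Γ 𝓑-limits ℂ) (Γ 𝓑-limits □ℂ)
  □♯ = _♯ □ □-preserves 𝓑-limits 𝓑-limits ℂ

  field
    ℍ   : InternalFunctor ℂ □ℂ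
    -- Γℍ ∘ F = F♯ ∘ F, where F♯ is □♯ along the identification ΓFℂ ≅ Γ□ℂ
    ℍ-F : EqualΓ 𝓑-limits □ℂ (ΓF 𝓑-limits ℍ ∘F F) (□♯ ∘F F)

  open Category 𝓑
  open FiniteLimits 𝓑-limits
  open GlobalArrow
  private
    module F = Functor F
    module □ = Functor □
    module ℍ = InternalFunctor ℍ
    module C = InternalCategory ℂ
    module □C = InternalCategory □ℂ
    open InternalFiniteLimits ℂ-limits using (⊤ᶜ)

    u : ⊤ ⇒ □.F₀ ⊤
    u = ⊤⇒G⊤ 𝓑-limits 𝓑-limits □-preserves

  ℍ-⊤ᶜ : ℍ.H₀ ∘ ⊤ᶜ ≈ Functor.F₀ □♯ ⊤ᶜ
  ℍ-⊤ᶜ = begin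
    ℍ.H₀ ∘ ⊤ᶜ           ≈⟨ ∘-respʳ strict-⊤ ⟨
    ℍ.H₀ ∘ F.F₀ ⊤       ≈⟨ EqualΓ.on-objects ℍ-F ⊤ ⟩
    □.F₁ (F.F₀ ⊤) ∘ u   ≈⟨ ∘-respˡ (□.F-resp-≈ strict-⊤) ⟩
    □.F₁ ⊤ᶜ ∘ u         ∎
    where
      open HomReasoning
      open StrictlyPreservesLimits F-strict using (strict-⊤)

  σ-iso : ∀ A → ℂ[_,_] 𝓑-limits □ℂ (ℍ.H₀ ∘ ⊤ᶜ) (ℍ.H₀ ∘ F.F₀ A) ≅ □.F₀ (□.F₀ A)
  σ-iso A = hom≅ □ □-preserves 𝓑-limits 𝓑-limits ℂ ℍ-⊤ᶜ (EqualΓ.on-objects ℍ-F A)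

  σ₀ : ∀ A → □.F₀ A ⇒ □.F₀ (□.F₀ A)
  σ₀ A = _≅_.to (σ-iso A) ∘ homMap 𝓑-limits ℍ ⊤ᶜ (F.F₀ A)

  private
    ι : ∀ {A} → □.F₀ A ⇒ C.C₁
    ι = incl 𝓑-limits ℂ

  □ι∘σ₀ : ∀ A → □.F₁ ι ∘ σ₀ A ≈ ℍ.H₁ ∘ ι
  □ι∘σ₀ A = Equiv.trans
    (pullˡ (Gincl∘hom≅ □ □-preserves 𝓑-limits 𝓑-limits ℂ ℍ-⊤ᶜ (EqualΓ.on-objects ℍ-F A)))
    (incl-hom 𝓑-limits □ℂ)

  private
    ι∘□ : ∀ {A B} (f : A ⇒ B) →
          ι ∘ □.F₁ f ≈ ι C.⨾ (arr (F.F₁ f) ∘ !)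
            [ postcompose-eq 𝓑-limits ℂ (cod-incl 𝓑-limits ℂ) (F.F₁ f) ]
    ι∘□ f = incl-postcompose 𝓑-limits ℂ (F.F₁ f)

  σ-natural : ∀ {A B} (f : A ⇒ B) → σ₀ B ∘ □.F₁ f ≈ □.F₁ (□.F₁ f) ∘ σ₀ A
  σ-natural {A} {B} f = Gincl-mono □ □-preserves 𝓑-limits 𝓑-limits ℂ (begin
    □.F₁ ι ∘ (σ₀ B ∘ □.F₁ f)                 ≈⟨ extendʳ (□ι∘σ₀ B) ⟩
    ℍ.H₁ ∘ (ι ∘ □.F₁ f)                      ≈⟨ ∘-respʳ (ι∘□ f) ⟩
    ℍ.H₁ ∘ (ι C.⨾ x [ e₁ ])                  ≈⟨ ℍ.H-⨾ ⟩
    (ℍ.H₁ ∘ ι) □C.⨾ (ℍ.H₁ ∘ x) [ ℍ.H-eq e₁ ] ≈⟨ □C.⨾-resp (□ι∘σ₀ A) □x ⟨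
    (□.F₁ ι ∘ σ₀ A) □C.⨾ (□.F₁ x ∘ σ₀ A) [ e₂ ] ≈⟨ □C.⨾-∘ ⟨
    (□.F₁ ι □C.⨾ □.F₁ x [ □.F-square e₁ ]) ∘ σ₀ A
      ≈⟨ ∘-respˡ (F₁-⨾ □ □-preserves ℂ Equiv.refl Equiv.refl) ⟨
    □.F₁ (ι C.⨾ x [ e₁ ]) ∘ σ₀ A             ≈⟨ ∘-respˡ (□.F-resp-≈ (ι∘□ f)) ⟨
    □.F₁ (ι ∘ □.F₁ f) ∘ σ₀ A                 ≈⟨ ∘-respˡ □.homomorphism ⟩
    (□.F₁ ι ∘ □.F₁ (□.F₁ f)) ∘ σ₀ A          ≈⟨ assoc ⟩
    □.F₁ ι ∘ (□.F₁ (□.F₁ f) ∘ σ₀ A)          ∎)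
    where
      open HomReasoning
      x : □.F₀ A ⇒ C.C₁
      x = arr (F.F₁ f) ∘ !
      e₁ : C.cod ∘ ι ≈ C.dom ∘ x
      e₁ = postcompose-eq 𝓑-limits ℂ (cod-incl 𝓑-limits ℂ) (F.F₁ f)
      e₂ : □.F₁ C.cod ∘ (□.F₁ ι ∘ σ₀ A) ≈ □.F₁ C.dom ∘ (□.F₁ x ∘ σ₀ A)
      e₂ = Equiv.trans (pullˡ (□.F-square e₁)) assoc
      □x : □.F₁ x ∘ σ₀ A ≈ ℍ.H₁ ∘ x
      □x = begin
        □.F₁ (arr (F.F₁ f) ∘ !) ∘ σ₀ A          ≈⟨ ∘-respˡ □.homomorphism ⟩
        (□.F₁ (arr (F.F₁ f)) ∘ □.F₁ !) ∘ σ₀ A   ≈⟨ assoc ⟩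
        □.F₁ (arr (F.F₁ f)) ∘ (□.F₁ ! ∘ σ₀ A)
          ≈⟨ ∘-respʳ (IsTerminal.!-unique₂ (G⊤-terminal 𝓑-limits 𝓑-limits □-preserves)) ⟩
        □.F₁ (arr (F.F₁ f)) ∘ (u ∘ !)           ≈⟨ sym-assoc ⟩
        (□.F₁ (arr (F.F₁ f)) ∘ u) ∘ !           ≈⟨ ∘-respˡ (EqualΓ.on-arrows ℍ-F f) ⟨
        (ℍ.H₁ ∘ arr (F.F₁ f)) ∘ !               ≈⟨ assoc ⟩
        ℍ.H₁ ∘ (arr (F.F₁ f) ∘ !)               ∎

  σ : NaturalTransformation □ (□ ∘F □)
  σ = record { η = σ₀ ; natural = σ-natural }

  □□ℂ : InternalCategory 𝓑
  □□ℂ = mapCategory □ □-preserves □ℂ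

  -- the internal functor ℍ♯_{Fℂ} : □ℂ → □□ℂ
  ℍ♯ : InternalFunctor □ℂ □□ℂ
  ℍ♯ = record
    { H₀     = σ₀ C.C₀
    ; H₁     = σ₀ C.C₁
    ; dom-H  = Equiv.sym (σ-natural C.dom)
    ; cod-H  = Equiv.sym (σ-natural C.cod)
    ; ε-H    = σ-natural C.ε
    ; comp-H = Equiv.trans (σ-natural C.comp)
        (□□C.comp∘ (Equiv.sym (σ-natural C.C₂.p₁)) (Equiv.sym (σ-natural C.C₂.p₂)))
    }
    where module □□C = InternalCategory □□ℂ

  □ℍ : InternalFunctor □ℂ □□ℂ
  □ℍ = mapFunctor □ □-preserves ℍ

record GeminalCategory (o ℓ e : Level) : Set (lsuc (o ⊔ ℓ ⊔ e)) where
  field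
    preGeminal : PreGeminalCategory o ℓ e
  open PreGeminalCategory preGeminal public
  field
    ℍ-strict  : InternallyStrict ℂ-limits □ℂ-limits ℍ
    ℍ-coassoc : □ℍ ∘I ℍ ≈I ℍ♯ ∘I ℍ

module _ {o ℓ e} {𝓑 : Category o ℓ e} {□ : Functor 𝓑 𝓑} where
  open Category 𝓑
  private module □ = Functor □

  CoAssociative : NaturalTransformation □ (□ ∘F □) → Set (o ⊔ e)
  CoAssociative δ = ∀ A → δ.η (□.F₀ A) ∘ δ.η A ≈ □.F₁ (δ.η A) ∘ δ.η A
    where module δ = NaturalTransformation δ

  record FixpointOperator (L : FiniteLimits 𝓑) (pres : PreservesFiniteLimits □)
         (δ : NaturalTransformation □ (□ ∘F □)) : Set (o ⊔ ℓ ⊔ e) where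
    open FiniteLimits L
    private module δ = NaturalTransformation δ
    infix 10 _†
    field
      _†        : ∀ {A B} → (B ×̂ □.F₀ A) ⇒ A → □.F₀ B ⇒ □.F₀ A
      †-resp-≈  : ∀ {A B} {f g : (B ×̂ □.F₀ A) ⇒ A} → f ≈ g → f † ≈ g †
      †-natural : ∀ {A B B′} (g : B′ ⇒ B) (f : (B ×̂ □.F₀ A) ⇒ A) →
                  (f ∘ (g ⁂ id)) † ≈ f † ∘ □.F₁ g
      †-fixed   : ∀ {A B} (f : (B ×̂ □.F₀ A) ⇒ A) →
                  f † ≈ □.F₁ f ∘ (_≅_.to (×≅G× L L pres B (□.F₀ A)) ∘ ⟨ id , δ.η A ∘ f † ⟩)

{-# OPTIONS --safe #-}

-- δ is σ. Both σ_A and the quotation map ρ : ℂ(FX,FY) → □ℂ(FX,FY) lie over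
-- ℍ₁, so the coassociativity of ℍ makes them coalgebras: σ ∘ ρ = □ρ ∘ ρ, and
-- likewise for σ_A.
--
-- For the fixpoints, write ⌜m⌝ : 1 → FC₁ for the quotation ℍ₁ m ∈ □C₁ of
-- m ∈ C₁. Consider the family over the m ∈ C₁ with cod m = FC₁ whose fibre at m
-- is the object of arrows into FA out of the pullback of m along ⌜m⌝. Its total
-- object has a projection w to C₁, and Fw is itself such an m. Let D be the
-- fibre of w over Fw. As F preserves the chosen pullbacks strictly and
-- ⌜Fw⌝ = F(Fw), the pullback of Fw along ⌜Fw⌝ is FD, so D unfolds to
-- H = ℂ(FD,FA). Now x ∈ H can be applied to its own quotation in □D, giving
-- s : H → □A with □s ∘ ρ = σ_A ∘ s. For f : B × □A → A, send b ∈ □B to the code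
-- t ↦ F(f ∘ (id × s))(b , t) in H; the composite □B → H → □A is f†.
module Submission where

open import Defs
open import Level using (Level)
open import Data.Product using (Σ-syntax; _×_; _,_)

-- Composition of generalised elements of hom-objects.

module HomComposition {o ℓ e} {𝓑 : Category o ℓ e} (L : FiniteLimits 𝓑)
       (ℂ : InternalCategory 𝓑) where
  open Category 𝓑
  open FiniteLimits L
  open InternalCategory ℂ
  open GlobalArrow

  Hom : ⊤ ⇒ C₀ → ⊤ ⇒ C₀ → Obj
  Hom = ℂ[_,_] L ℂ

  ι : ∀ {X Y} → Hom X Y ⇒ C₁
  ι = incl L ℂ

  post : ∀ {X Y Z} → GlobalArrow L ℂ Y Z → Hom X Y ⇒ Hom X Z
  post = postcompose L ℂ

  ⊙-eq : ∀ {T X Y Z} {x : T ⇒ Hom X Y} {y : T ⇒ Hom Y Z} → cod ∘ (ι ∘ x) ≈ dom ∘ (ι ∘ y)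
  ⊙-eq = Equiv.trans (cod-incl∘ L ℂ) (Equiv.sym (dom-incl∘ L ℂ))

  infixr 8 _⊙_

  opaque
    -- Taken on elements at a stage `T`, so that no product of hom-objects appears. Since `ι` is
    -- monic, `ι-⊙` determines it.
    _⊙_ : ∀ {T X Y Z} → T ⇒ Hom X Y → T ⇒ Hom Y Z → T ⇒ Hom X Z
    x ⊙ y = hom⟨_⟩[_,_] L ℂ ((ι ∘ x) ⨾ (ι ∘ y) [ ⊙-eq ])
      (Equiv.trans dom-⨾ (dom-incl∘ L ℂ)) (Equiv.trans cod-⨾ (cod-incl∘ L ℂ))

    ι-⊙ : ∀ {T X Y Z} {x : T ⇒ Hom X Y} {y : T ⇒ Hom Y Z} →
          ι ∘ (x ⊙ y) ≈ (ι ∘ x) ⨾ (ι ∘ y) [ ⊙-eq ]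
    ι-⊙ = incl-hom L ℂ

    const-id : ∀ {T X} → T ⇒ Hom X X
    const-id {X = X} = hom⟨_⟩[_,_] L ℂ (ε ∘ (X ∘ !))
      (Equiv.trans (pullˡ dom-ε) identityˡ) (Equiv.trans (pullˡ cod-ε) identityˡ)

    ι-const-id : ∀ {T X} → ι ∘ const-id {T} {X} ≈ ε ∘ (X ∘ !)
    ι-const-id = incl-hom L ℂ

  ⊙-resp : ∀ {T X Y Z} {x x′ : T ⇒ Hom X Y} {y y′ : T ⇒ Hom Y Z} →
           x ≈ x′ → y ≈ y′ → x ⊙ y ≈ x′ ⊙ y′
  ⊙-resp p q = incl-mono L ℂ (Equiv.trans ι-⊙
    (Equiv.trans (⨾-resp (∘-respʳ p) (∘-respʳ q)) (Equiv.sym ι-⊙)))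

  ⊙-∘ : ∀ {S T X Y Z} {x : T ⇒ Hom X Y} {y : T ⇒ Hom Y Z} {t : S ⇒ T} →
        (x ⊙ y) ∘ t ≈ (x ∘ t) ⊙ (y ∘ t)
  ⊙-∘ {x = x} {y} {t} = incl-mono L ℂ (begin
    ι ∘ ((x ⊙ y) ∘ t)                      ≈⟨ pullˡ ι-⊙ ⟩
    ((ι ∘ x) ⨾ (ι ∘ y) [ ⊙-eq ]) ∘ t       ≈⟨ ⨾-∘ {p′ = Equiv.trans (pullˡ ⊙-eq) assoc} ⟩
    ((ι ∘ x) ∘ t) ⨾ ((ι ∘ y) ∘ t) [ _ ]    ≈⟨ ⨾-resp assoc assoc ⟩
    (ι ∘ (x ∘ t)) ⨾ (ι ∘ (y ∘ t)) [ ⊙-eq ] ≈⟨ ι-⊙ ⟨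
    ι ∘ ((x ∘ t) ⊙ (y ∘ t))                ∎)
    where open HomReasoning

  ⊙-assoc : ∀ {T W X Y Z} {x : T ⇒ Hom W X} {y : T ⇒ Hom X Y} {z : T ⇒ Hom Y Z} →
            (x ⊙ y) ⊙ z ≈ x ⊙ (y ⊙ z)
  ⊙-assoc {x = x} {y} {z} = incl-mono L ℂ (begin
    ι ∘ ((x ⊙ y) ⊙ z)             ≈⟨ ι-⊙ ⟩
    (ι ∘ (x ⊙ y)) ⨾ (ι ∘ z) [ _ ] ≈⟨ ⨾-resp ι-⊙ Equiv.refl ⟩
    ((ι ∘ x) ⨾ (ι ∘ y) [ ⊙-eq ]) ⨾ (ι ∘ z) [ Equiv.trans cod-⨾ ⊙-eq ]
                                  ≈⟨ ⨾-assoc ⟩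
    (ι ∘ x) ⨾ ((ι ∘ y) ⨾ (ι ∘ z) [ ⊙-eq ]) [ Equiv.trans ⊙-eq (Equiv.sym dom-⨾) ]
                                  ≈⟨ ⨾-resp Equiv.refl ι-⊙ ⟨
    (ι ∘ x) ⨾ (ι ∘ (y ⊙ z)) [ _ ] ≈⟨ ι-⊙ ⟨
    ι ∘ (x ⊙ (y ⊙ z))             ∎)
    where open HomReasoning

  ⊙-identityˡ : ∀ {T X Y} {x : T ⇒ Hom X Y} → const-id ⊙ x ≈ x
  ⊙-identityˡ = incl-mono L ℂ (Equiv.trans ι-⊙
    (Equiv.trans (⨾-resp {p′ = Equiv.trans (pullˡ cod-ε)
                   (Equiv.trans identityˡ (Equiv.sym (dom-incl∘ L ℂ)))} ι-const-id Equiv.refl)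
      ⨾-identityˡ))

  ⊙-identityʳ : ∀ {T X Y} {x : T ⇒ Hom X Y} → x ⊙ const-id ≈ x
  ⊙-identityʳ = incl-mono L ℂ (Equiv.trans ι-⊙
    (Equiv.trans (⨾-resp {p′ = Equiv.trans (cod-incl∘ L ℂ)
                   (Equiv.sym (Equiv.trans (pullˡ dom-ε) identityˡ))} Equiv.refl ι-const-id)
      ⨾-identityʳ))

  const-id-∘ : ∀ {S T X} {t : S ⇒ T} → const-id {X = X} ∘ t ≈ const-id
  const-id-∘ = incl-mono L ℂ (Equiv.trans (pullˡ ι-const-id)
    (Equiv.trans assoc (Equiv.trans (∘-respʳ (Equiv.trans assoc (∘-respʳ !-unique₂)))
      (Equiv.sym ι-const-id))))

  ι-post∘ : ∀ {T X Y Z} (g : GlobalArrow L ℂ Y Z) {x : T ⇒ Hom X Y} →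
            ι ∘ (post g ∘ x) ≈ (ι ∘ x) ⨾ (arr g ∘ !) [ postcompose-eq L ℂ (cod-incl∘ L ℂ) g ]
  ι-post∘ g = incl-postcompose∘ L ℂ g

  -- Associativity with the constant `g` as third factor. With source `⊤ᶜ` and `g` an image under
  -- `F`, `post g` is the action of `□`, so this computes `□` of an arrow on a composite.
  post-⊙ : ∀ {T X Y Z W} (g : GlobalArrow L ℂ Z W) {x : T ⇒ Hom X Y} {y : T ⇒ Hom Y Z} →
           post g ∘ (x ⊙ y) ≈ x ⊙ (post g ∘ y)
  post-⊙ g {x} {y} = incl-mono L ℂ (begin
    ι ∘ (post g ∘ (x ⊙ y))                  ≈⟨ ι-post∘ g ⟩
    (ι ∘ (x ⊙ y)) ⨾ (arr g ∘ !) [ _ ]       ≈⟨ ⨾-resp ι-⊙ Equiv.refl ⟩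
    ((ι ∘ x) ⨾ (ι ∘ y) [ ⊙-eq ]) ⨾ (arr g ∘ !) [ Equiv.trans cod-⨾ g-eq ]
                                            ≈⟨ ⨾-assoc ⟩
    (ι ∘ x) ⨾ ((ι ∘ y) ⨾ (arr g ∘ !) [ g-eq ]) [ Equiv.trans ⊙-eq (Equiv.sym dom-⨾) ]
                                            ≈⟨ ⨾-resp Equiv.refl (ι-post∘ g) ⟨
    (ι ∘ x) ⨾ (ι ∘ (post g ∘ y)) [ _ ]      ≈⟨ ι-⊙ ⟨
    ι ∘ (x ⊙ (post g ∘ y))                  ∎)
    where
      open HomReasoning
      g-eq = postcompose-eq L ℂ (cod-incl∘ L ℂ) g

-- Terminal maps, and products of images under `F`, seen from an arbitrary source.

module ImageProducts {o ℓ e} {𝓑 : Category o ℓ e} {L : FiniteLimits 𝓑}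
       {ℂ : InternalCategory 𝓑} {M : InternalFiniteLimits L ℂ} {F : Functor 𝓑 (Γ L ℂ)}
       (S : StrictlyPreservesLimits L M F) where
  open Category 𝓑
  open FiniteLimits L
  open InternalCategory ℂ
  open InternalFiniteLimits M
  open InternalLimitProperties M
  open StrictlyPreservesLimits S
  open GlobalArrow
  open HomComposition L ℂ
  private module F = Functor F

  into-⊤ : ∀ {T X} → T ⇒ Hom X ⊤ᶜ
  into-⊤ {X = X} = hom⟨_⟩[_,_] L ℂ (bang ∘ (X ∘ !))
    (Equiv.trans (pullˡ dom-bang) identityˡ)
    (Equiv.trans (extendʳ cod-bang) (∘-respʳ !-unique₂))

  into-⊤-unique : ∀ {T X} {x y : T ⇒ Hom X ⊤ᶜ} → x ≈ y
  into-⊤-unique = incl-mono L ℂ (into-top-unique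
    (Equiv.trans (dom-incl∘ L ℂ) (Equiv.sym (dom-incl∘ L ℂ)))
    (cod-incl∘ L ℂ) (cod-incl∘ L ℂ))

  weaken : ∀ {T X Y} → T ⇒ Hom ⊤ᶜ Y → T ⇒ Hom X Y
  weaken b = into-⊤ ⊙ b

  weaken-∘ : ∀ {S T X Y} {b : T ⇒ Hom ⊤ᶜ Y} {t : S ⇒ T} →
             weaken {X = X} b ∘ t ≈ weaken (b ∘ t)
  weaken-∘ = Equiv.trans ⊙-∘ (⊙-resp into-⊤-unique Equiv.refl)

  -- `weaken b` is the constant arrow at `b`; it ignores `x` because `x ⊙ into-⊤` goes from `⊤ᶜ` to
  -- itself and hence is the identity.
  ⊙-weaken : ∀ {T X Y} {x : T ⇒ Hom ⊤ᶜ X} {b : T ⇒ Hom ⊤ᶜ Y} → x ⊙ weaken b ≈ b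
  ⊙-weaken {x = x} {b} = begin
    x ⊙ (into-⊤ ⊙ b)  ≈⟨ ⊙-assoc ⟨
    (x ⊙ into-⊤) ⊙ b  ≈⟨ ⊙-resp into-⊤-unique Equiv.refl ⟩
    const-id ⊙ b      ≈⟨ ⊙-identityˡ ⟩
    b                 ∎
    where open HomReasoning

  -- `F.F₀ ⊤` is only `≈`-equal to `⊤ᶜ`, so the codomains are first moved along `strict-⊤`.
  into-F⊤-unique : ∀ {T X} {x y : T ⇒ Hom X (F.F₀ ⊤)} → x ≈ y
  into-F⊤-unique = incl-mono L ℂ (into-top-unique
    (Equiv.trans (dom-incl∘ L ℂ) (Equiv.sym (dom-incl∘ L ℂ)))
    (Equiv.trans (cod-incl∘ L ℂ) (∘-respˡ strict-⊤))
    (Equiv.trans (cod-incl∘ L ℂ) (∘-respˡ strict-⊤)))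

  module _ {A B : Obj} where
    private
      module P = γ-Pullback L ℂ M (F.F₁ (! {A})) (F.F₁ (! {B}))

    cod-apex : ∀ {T X} {x : T ⇒ Hom X (F.F₀ (A ×̂ B))} → cod ∘ (ι ∘ x) ≈ apex ∘ (P.c ∘ !)
    cod-apex = Equiv.trans (cod-incl∘ L ℂ) (Equiv.trans (∘-respˡ (strict-P ! !)) assoc)

    -- Strictness turns `F π₁` into the internal projection `pb₁` at the cospan `P.c` of the two
    -- maps `F !`, so that internal mediating arrows apply.
    cone₁-ι : ∀ {T X} {x : T ⇒ Hom X (F.F₀ (A ×̂ B))} →
              ι ∘ (post (F.F₁ π₁) ∘ x) ≈ cone₁ (cod-apex {x = x})
    cone₁-ι = Equiv.trans (ι-post∘ (F.F₁ π₁))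
      (⨾-resp Equiv.refl (Equiv.trans (∘-respˡ (strict-p₁ ! !)) assoc))

    cone₂-ι : ∀ {T X} {x : T ⇒ Hom X (F.F₀ (A ×̂ B))} →
              ι ∘ (post (F.F₁ π₂) ∘ x) ≈ cone₂ (cod-apex {x = x})
    cone₂-ι = Equiv.trans (ι-post∘ (F.F₁ π₂))
      (⨾-resp Equiv.refl (Equiv.trans (∘-respˡ (strict-p₂ ! !)) assoc))

    pair-unique : ∀ {T X} {x y : T ⇒ Hom X (F.F₀ (A ×̂ B))} →
                  post (F.F₁ π₁) ∘ x ≈ post (F.F₁ π₁) ∘ y →
                  post (F.F₁ π₂) ∘ x ≈ post (F.F₁ π₂) ∘ y → x ≈ y
    pair-unique p q = incl-mono L ℂ (med-unique₂ cod-apex cod-apex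
      (Equiv.trans (Equiv.sym cone₁-ι) (Equiv.trans (∘-respʳ p) cone₁-ι))
      (Equiv.trans (Equiv.sym cone₂-ι) (Equiv.trans (∘-respʳ q) cone₂-ι)))

    module _ {T X} (a : T ⇒ Hom X (F.F₀ A)) (b : T ⇒ Hom X (F.F₀ B)) where
      private
        module Me = Mediate (arr (F.F₁ (! {A})) ∘ !) (arr (F.F₁ (! {B})) ∘ !) (ι ∘ a) (ι ∘ b)
          P.c-eq (postcompose-eq L ℂ (cod-incl∘ L ℂ) (F.F₁ !))
          (postcompose-eq L ℂ (cod-incl∘ L ℂ) (F.F₁ !))
          -- The square commutes because arrows into `F.F₀ ⊤` are unique.
          (Equiv.trans (Equiv.sym (ι-post∘ (F.F₁ !)))
            (Equiv.trans (∘-respʳ into-F⊤-unique) (ι-post∘ (F.F₁ !))))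

      opaque
        -- `γ-preserves` covers only the source `⊤ᶜ`; the codes below have source `F D`, hence the
        -- direct use of the internal mediating arrow.
        pair : T ⇒ Hom X (F.F₀ (A ×̂ B))
        pair = hom⟨_⟩[_,_] L ℂ Me.mediate
          (Equiv.trans Me.dom-mediate (dom-incl∘ L ℂ))
          (Equiv.trans Me.cod-mediate (Equiv.trans (∘-respʳ (Equiv.sym P.c!))
            (Equiv.trans sym-assoc (∘-respˡ (Equiv.sym (strict-P ! !))))))

        π₁-pair : post (F.F₁ π₁) ∘ pair ≈ a
        π₁-pair = incl-mono L ℂ (Equiv.trans cone₁-ι
          (Equiv.trans (cone₁-resp cod-apex Me.cod-mediate (incl-hom L ℂ) P.c!) Me.mediate-pb₁))

        π₂-pair : post (F.F₁ π₂) ∘ pair ≈ b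
        π₂-pair = incl-mono L ℂ (Equiv.trans cone₂-ι
          (Equiv.trans (cone₂-resp cod-apex Me.cod-mediate (incl-hom L ℂ) P.c!) Me.mediate-pb₂))

-- Quotation of arrows of `ℂ` inside `ℂ`.

module Quotation {o ℓ e} (𝓟 : PreGeminalCategory o ℓ e) where
  open PreGeminalCategory 𝓟
  open Category 𝓑
  open FiniteLimits 𝓑-limits
  open InternalCategory ℂ
  open InternalFiniteLimits ℂ-limits
  open InternalLimitProperties ℂ-limits
  open StrictlyPreservesLimits F-strict
  open GlobalArrow
  open HomComposition 𝓑-limits ℂ
  open ImageProducts F-strict
  private
    module F = Functor F
    module □ = Functor □
    module ℍ = InternalFunctor ℍ

  -- `ℍ.H₁` lands in `□ C₁`, the hom-object from `⊤ᶜ` to `F C₁`; `ι` reads the result as an arrow of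
  -- `ℂ` again.
  quotation : C₁ ⇒ C₁
  quotation = ι {⊤ᶜ} {F.F₀ C₁} ∘ ℍ.H₁

  cod-quotation : cod ∘ quotation ≈ F.F₀ C₁ ∘ !
  cod-quotation = cod-incl∘ 𝓑-limits ℂ

  -- By `ℍ-F` the code of `m` is `□ m ∘ u`, which `ι` turns into `ι ∘ u` followed by `F m`. Here
  -- `ι ∘ u` is an identity, since its codomain is terminal.
  quotation-F : ∀ {A B} (f : A ⇒ B) →
                quotation ∘ arr (F.F₁ f) ≈ arr (F.F₁ (arr (F.F₁ f)))
  quotation-F f = begin
    quotation ∘ m                             ≈⟨ assoc ⟩
    ι ∘ (ℍ.H₁ ∘ m)                            ≈⟨ ∘-respʳ (EqualΓ.on-arrows ℍ-F f) ⟩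
    ι ∘ (□.F₁ m ∘ u)                          ≈⟨ ι-post∘ (F.F₁ m) ⟩
    (ι ∘ u) ⨾ (arr (F.F₁ m) ∘ !) [ _ ]
      ≈⟨ ⨾-resp ι-u (Equiv.trans (∘-respʳ !-unique₂) identityʳ) ⟩
    (ε ∘ F.F₀ ⊤) ⨾ arr (F.F₁ m) [ Equiv.trans (pullˡ cod-ε)
      (Equiv.trans identityˡ (Equiv.sym (dom-arr (F.F₁ m)))) ]
                                              ≈⟨ ⨾-identityˡ ⟩
    arr (F.F₁ m)                              ∎
    where
      open HomReasoning
      m : ⊤ ⇒ C₁
      m = arr (F.F₁ f)
      u : ⊤ ⇒ □.F₀ ⊤
      u = ⊤⇒G⊤ 𝓑-limits 𝓑-limits □-preserves
      F⊤! : F.F₀ ⊤ ≈ ⊤ᶜ ∘ !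
      F⊤! = Equiv.trans strict-⊤ (Equiv.trans (Equiv.sym identityʳ) (∘-respʳ !-unique₂))
      ι-u : ι ∘ u ≈ ε ∘ F.F₀ ⊤
      ι-u = into-top-unique
        (Equiv.trans (dom-incl∘ 𝓑-limits ℂ)
          (Equiv.sym (Equiv.trans (pullˡ dom-ε) (Equiv.trans identityˡ F⊤!))))
        (Equiv.trans (cod-incl∘ 𝓑-limits ℂ) (∘-respˡ strict-⊤))
        (Equiv.trans (pullˡ cod-ε) (Equiv.trans identityˡ F⊤!))

  -- An object `D` having `Hom (F D) (F A)` as a retract.

  module ReflexiveObject (A : Obj) where
    private
      module V = Pullback (pullback cod (F.F₀ C₁))
      module E = Pullback (pullback cod (F.F₀ A))

    diagonal-eq : cod ∘ V.p₁ ≈ cod ∘ (quotation ∘ V.p₁)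
    diagonal-eq = Equiv.trans V.commute (Equiv.sym
      (Equiv.trans (pullˡ cod-quotation) (Equiv.trans assoc (∘-respʳ !-unique₂))))

    -- m ↦ the domain of the pullback of m along its quotation
    diagonal : V.P ⇒ C₀
    diagonal = apex ∘ Cospan.universal V.p₁ (quotation ∘ V.p₁) diagonal-eq

    private
      -- The total object of the family: an `m` in `V` with an arrow in `E` out of `diagonal` at
      -- `m`.
      module W = Pullback (pullback diagonal (dom ∘ E.p₁))

    w : W.P ⇒ C₁
    w = V.p₁ ∘ W.p₁

    private
      m : ⊤ ⇒ C₁
      m = arr (F.F₁ w)
      -- `m` is `F w`, whose codomain is `F C₁`, so the family can be evaluated at it; `D` is the
      -- fibre there.
      module D = Pullback (pullback w m)

    D : Obj
    D = D.P

    -- By `quotation-F` the quotation of `m` is `F m`, so the cospan is the image of `w` and `m`,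
    -- and `strict-P` identifies its apex with `F D`.
    diagonal-m : ∀ {T} {t : T ⇒ V.P} → V.p₁ ∘ t ≈ m ∘ ! → diagonal ∘ t ≈ F.F₀ D ∘ !
    diagonal-m {t = t} p = begin
      diagonal ∘ t ≈⟨ assoc ⟩
      apex ∘ (Cospan.universal V.p₁ (quotation ∘ V.p₁) diagonal-eq ∘ t)
        ≈⟨ ∘-respʳ (Cospan.unique
             (Equiv.trans (pullˡ Cospan.p₁∘universal)
               (Equiv.trans p (Equiv.sym (pullˡ Cospan.p₁∘universal))))
             (Equiv.trans (pullˡ Cospan.p₂∘universal) (Equiv.trans assoc
               (Equiv.trans (∘-respʳ p) (Equiv.trans (pullˡ (quotation-F w))
                 (Equiv.sym (pullˡ Cospan.p₂∘universal))))))) ⟩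
      apex ∘ (Γ-cospan 𝓑-limits ℂ ℂ-limits (F.F₁ w) (F.F₁ m) ∘ !) ≈⟨ sym-assoc ⟩
      (apex ∘ Γ-cospan 𝓑-limits ℂ ℂ-limits (F.F₁ w) (F.F₁ m)) ∘ ! ≈⟨ ∘-respˡ (strict-P w m) ⟨
      F.F₀ D ∘ ! ∎
      where open HomReasoning

    unfold : D ⇒ Hom (F.F₀ D) (F.F₀ A)
    unfold = hom⟨_⟩[_,_] 𝓑-limits ℂ (E.p₁ ∘ (W.p₂ ∘ D.p₁))
      (begin
        dom ∘ (E.p₁ ∘ (W.p₂ ∘ D.p₁))   ≈⟨ sym-assoc ⟩
        (dom ∘ E.p₁) ∘ (W.p₂ ∘ D.p₁)   ≈⟨ extendʳ W.commute ⟨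
        diagonal ∘ (W.p₁ ∘ D.p₁)       ≈⟨ diagonal-m (Equiv.trans sym-assoc
                                            (Equiv.trans D.commute (∘-respʳ !-unique₂))) ⟩
        F.F₀ D ∘ !                     ∎)
      (Equiv.trans (extendʳ E.commute) (∘-respʳ !-unique₂))
      where open HomReasoning

    private
      e₀ : Hom (F.F₀ D) (F.F₀ A) ⇒ E.P
      e₀ = E.universal ι ! (cod-incl 𝓑-limits ℂ)

      v₀ : Hom (F.F₀ D) (F.F₀ A) ⇒ V.P
      v₀ = V.universal (m ∘ !) ! (cod-arr! 𝓑-limits ℂ (F.F₁ w))

      w₀ : Hom (F.F₀ D) (F.F₀ A) ⇒ W.P
      w₀ = W.universal v₀ e₀ (Equiv.trans (diagonal-m V.p₁∘universal)
        (Equiv.sym (Equiv.trans assoc (Equiv.trans (∘-respʳ E.p₁∘universal)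
          (dom-incl 𝓑-limits ℂ)))))

    fold : Hom (F.F₀ D) (F.F₀ A) ⇒ D
    fold = D.universal w₀ !
      (Equiv.trans assoc (Equiv.trans (∘-respʳ W.p₁∘universal) V.p₁∘universal))

    -- Folding stores the arrow as the `E` component over the constant `m`; unfolding reads it back.
    unfold∘fold : unfold ∘ fold ≈ id
    unfold∘fold = incl-mono 𝓑-limits ℂ (begin
      ι ∘ (unfold ∘ fold)                  ≈⟨ pullˡ (incl-hom 𝓑-limits ℂ) ⟩
      (E.p₁ ∘ (W.p₂ ∘ D.p₁)) ∘ fold        ≈⟨ assoc ⟩
      E.p₁ ∘ ((W.p₂ ∘ D.p₁) ∘ fold)        ≈⟨ ∘-respʳ assoc ⟩
      E.p₁ ∘ (W.p₂ ∘ (D.p₁ ∘ fold))        ≈⟨ ∘-respʳ (∘-respʳ D.p₁∘universal) ⟩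
      E.p₁ ∘ (W.p₂ ∘ w₀)                   ≈⟨ ∘-respʳ W.p₂∘universal ⟩
      E.p₁ ∘ e₀                            ≈⟨ E.p₁∘universal ⟩
      ι                                    ≈⟨ identityʳ ⟨
      ι ∘ id                               ∎)
      where open HomReasoning

  opaque
    -- The map ρ, built like `σ₀` but with an arbitrary image `F A` as source in place of `⊤ᶜ`.
    quote-hom : ∀ {A B} → Hom (F.F₀ A) (F.F₀ B) ⇒ □.F₀ (Hom (F.F₀ A) (F.F₀ B))
    quote-hom {A} {B} = _≅_.to (hom≅ □ □-preserves 𝓑-limits 𝓑-limits ℂ
      (EqualΓ.on-objects ℍ-F A) (EqualΓ.on-objects ℍ-F B)) ∘ homMap 𝓑-limits ℍ (F.F₀ A) (F.F₀ B)

    □ι∘quote-hom : ∀ {A B} → □.F₁ ι ∘ quote-hom {A} {B} ≈ ℍ.H₁ ∘ ι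
    □ι∘quote-hom {A} {B} = Equiv.trans
      (pullˡ (Gincl∘hom≅ □ □-preserves 𝓑-limits 𝓑-limits ℂ
        (EqualΓ.on-objects ℍ-F A) (EqualΓ.on-objects ℍ-F B)))
      (incl-hom 𝓑-limits □ℂ)

-- Comultiplication, self-application and fixpoints.

module FixpointConstruction {o ℓ e} (𝓟 : PreGeminalCategory o ℓ e)
       (ℍ-coassoc : PreGeminalCategory.□ℍ 𝓟 ∘I PreGeminalCategory.ℍ 𝓟 ≈I
                    PreGeminalCategory.ℍ♯ 𝓟 ∘I PreGeminalCategory.ℍ 𝓟) where
  open PreGeminalCategory 𝓟
  open Category 𝓑
  open FiniteLimits 𝓑-limits
  open InternalCategory ℂ
  open HomComposition 𝓑-limits ℂ
  open ImageProducts F-strict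
  open Quotation 𝓟
  private
    module F = Functor F
    module □ = Functor □
    module ℍ = InternalFunctor ℍ
    module □C = InternalCategory □ℂ

  -- Opaque for type-checking speed only; □ι∘δ₀ determines it, since □ι is
  -- monic. For the same reason C₁ is spelled out in ℍ₁-coassoc.
  opaque
    δ₀ : ∀ A → □.F₀ A ⇒ □.F₀ (□.F₀ A)
    δ₀ = σ₀

    δ₀-natural : ∀ {A B} (f : A ⇒ B) → δ₀ B ∘ □.F₁ f ≈ □.F₁ (□.F₁ f) ∘ δ₀ A
    δ₀-natural = σ-natural

    □ι∘δ₀ : ∀ A → □.F₁ ι ∘ δ₀ A ≈ ℍ.H₁ ∘ ι
    □ι∘δ₀ = □ι∘σ₀

    ℍ₁-coassoc : □.F₁ ℍ.H₁ ∘ ℍ.H₁ ≈ δ₀ (InternalCategory.C₁ ℂ) ∘ ℍ.H₁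
    ℍ₁-coassoc = ℍ-coassoc ._≈I_.≈₁

  δ : NaturalTransformation □ (□ ∘F □)
  δ = record { η = δ₀ ; natural = δ₀-natural }

  -- `□ ∘F □` preserves finite limits, so `□ (□ ι)` is monic; after it the two sides become those of
  -- `ℍ₁-coassoc` precomposed with `ι`. A general lift `s` covers both `δ₀` and `quote-hom`.
  coalgebra : ∀ {X Y} {s : Hom X Y ⇒ □.F₀ (Hom X Y)} → □.F₁ ι ∘ s ≈ ℍ.H₁ ∘ ι →
              δ₀ (Hom X Y) ∘ s ≈ □.F₁ s ∘ s
  coalgebra {X} {Y} {s} p =
    Gincl-mono (□ ∘F □) (pres-∘ □-preserves □-preserves) 𝓑-limits 𝓑-limits ℂ (begin
      □.F₁ (□.F₁ ι) ∘ (δ₀ (Hom X Y) ∘ s) ≈⟨ extendʳ (δ₀-natural ι) ⟨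
      δ₀ C₁ ∘ (□.F₁ ι ∘ s)               ≈⟨ ∘-respʳ p ⟩
      δ₀ C₁ ∘ (ℍ.H₁ ∘ ι)                 ≈⟨ extendʳ ℍ₁-coassoc ⟨
      □.F₁ ℍ.H₁ ∘ (ℍ.H₁ ∘ ι)             ≈⟨ ∘-respʳ p ⟨
      □.F₁ ℍ.H₁ ∘ (□.F₁ ι ∘ s)           ≈⟨ extendʳ (□.F-square p) ⟨
      □.F₁ (□.F₁ ι) ∘ (□.F₁ s ∘ s)       ∎)
    where open HomReasoning

  δ-coassoc : CoAssociative δ
  δ-coassoc A = coalgebra (□ι∘δ₀ A)

  □ι-⊙ : ∀ {S T X Y Z} {x : T ⇒ Hom X Y} {y : T ⇒ Hom Y Z} {t : S ⇒ □.F₀ T}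
         {x′ y′ : S ⇒ □C.C₁} {p : □C.cod ∘ x′ ≈ □C.dom ∘ y′} →
         □.F₁ (ι ∘ x) ∘ t ≈ x′ → □.F₁ (ι ∘ y) ∘ t ≈ y′ →
         □.F₁ ι ∘ (□.F₁ (x ⊙ y) ∘ t) ≈ x′ □C.⨾ y′ [ p ]
  □ι-⊙ {x = x} {y} {t} {x′} {y′} {p} r s = begin
    □.F₁ ι ∘ (□.F₁ (x ⊙ y) ∘ t)                  ≈⟨ pullˡ (□.F-triangle ι-⊙) ⟩
    □.F₁ ((ι ∘ x) ⨾ (ι ∘ y) [ ⊙-eq ]) ∘ t        ≈⟨ ∘-respˡ (F₁-⨾ □ □-preserves ℂ Equiv.refl Equiv.refl) ⟩
    (□.F₁ (ι ∘ x) □C.⨾ □.F₁ (ι ∘ y) [ □.F-square ⊙-eq ]) ∘ t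
      ≈⟨ □C.⨾-∘ {p′ = Equiv.trans (pullˡ (□.F-square ⊙-eq)) assoc} ⟩
    (□.F₁ (ι ∘ x) ∘ t) □C.⨾ (□.F₁ (ι ∘ y) ∘ t) [ _ ] ≈⟨ □C.⨾-resp r s ⟩
    x′ □C.⨾ y′ [ p ]                             ∎
    where open HomReasoning

  -- Self-application of coded arrows.

  module _ {A : Obj} where
    open ReflexiveObject A

    private
      H : Obj
      H = Hom (F.F₀ D) (F.F₀ A)
      module Hom-F = Functor (homFunctor 𝓑-limits ℂ (F.F₀ D) ∘F F)

    quote-folded : H ⇒ □.F₀ D
    quote-folded = □.F₁ fold ∘ quote-hom

    □unfold∘quote-folded : □.F₁ unfold ∘ quote-folded ≈ quote-hom
    □unfold∘quote-folded = Equiv.trans (pullˡ (Equiv.trans (□.F-triangle unfold∘fold) □.identity))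
      identityˡ

    -- The map s: the generic arrow `id` from `F D` to `F A`, applied to its own quotation as a
    -- global section of `F D`.
    self-apply : H ⇒ □.F₀ A
    self-apply = quote-folded ⊙ id

    -- Compared under the monic `□ ι`, where `ℍ` preserves the composition defining `self-apply`.
    -- The function factor is quoted by `quote-hom` itself. The argument factor is already a
    -- quotation; naturality of `δ₀` and `coalgebra` handle its second quotation.
    δ₀∘self-apply : δ₀ A ∘ self-apply ≈ □.F₁ self-apply ∘ quote-hom
    δ₀∘self-apply = Gincl-mono □ □-preserves 𝓑-limits 𝓑-limits ℂ (begin
      □.F₁ ι ∘ (δ₀ A ∘ self-apply)            ≈⟨ extendʳ (□ι∘δ₀ A) ⟩
      ℍ.H₁ ∘ (ι ∘ self-apply)                 ≈⟨ ∘-respʳ ι-⊙ ⟩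
      ℍ.H₁ ∘ ((ι ∘ quote-folded) ⨾ (ι ∘ id) [ ⊙-eq ]) ≈⟨ ℍ.H-⨾ ⟩
      (ℍ.H₁ ∘ (ι ∘ quote-folded)) □C.⨾ (ℍ.H₁ ∘ (ι ∘ id)) [ ℍ.H-eq ⊙-eq ]
        ≈⟨ □ι-⊙ argument function ⟨
      □.F₁ ι ∘ (□.F₁ self-apply ∘ quote-hom)  ∎)
      where
        open HomReasoning
        δ₀-folded : δ₀ D ∘ quote-folded ≈ □.F₁ quote-folded ∘ quote-hom
        δ₀-folded = begin
          δ₀ D ∘ quote-folded                               ≈⟨ extendʳ (δ₀-natural fold) ⟩
          □.F₁ (□.F₁ fold) ∘ (δ₀ H ∘ quote-hom)             ≈⟨ ∘-respʳ (coalgebra □ι∘quote-hom) ⟩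
          □.F₁ (□.F₁ fold) ∘ (□.F₁ quote-hom ∘ quote-hom)   ≈⟨ pullˡ (Equiv.sym □.homomorphism) ⟩
          □.F₁ quote-folded ∘ quote-hom                     ∎
        argument : □.F₁ (ι ∘ quote-folded) ∘ quote-hom ≈ ℍ.H₁ ∘ (ι ∘ quote-folded)
        argument = begin
          □.F₁ (ι ∘ quote-folded) ∘ quote-hom           ≈⟨ ∘-respˡ □.homomorphism ⟩
          (□.F₁ ι ∘ □.F₁ quote-folded) ∘ quote-hom      ≈⟨ assoc ⟩
          □.F₁ ι ∘ (□.F₁ quote-folded ∘ quote-hom)      ≈⟨ ∘-respʳ δ₀-folded ⟨
          □.F₁ ι ∘ (δ₀ D ∘ quote-folded)                ≈⟨ extendʳ (□ι∘δ₀ D) ⟩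
          ℍ.H₁ ∘ (ι ∘ quote-folded)                     ∎
        function : □.F₁ (ι ∘ id) ∘ quote-hom ≈ ℍ.H₁ ∘ (ι ∘ id)
        function = Equiv.trans (∘-respˡ (□.F-resp-≈ identityʳ))
          (Equiv.trans □ι∘quote-hom (∘-respʳ (Equiv.sym identityʳ)))

    -- The arrow `t ↦ (b , t)` for `b` in `□ B`: the constant `b` paired with the identity of `F D`.
    with-parameter : ∀ B → □.F₀ B ⇒ Hom (F.F₀ D) (F.F₀ (B ×̂ D))
    with-parameter B = pair (weaken id) const-id

    -- Checked on both projections: `g` acts on the constant component only.
    with-parameter-natural : ∀ {B B′} (g : B′ ⇒ B) →
      post (F.F₁ (g ⁂ id)) ∘ with-parameter B′ ≈ with-parameter B ∘ □.F₁ g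
    with-parameter-natural {B} {B′} g = pair-unique
      (begin
        post (F.F₁ π₁) ∘ (post (F.F₁ (g ⁂ id)) ∘ with-parameter B′)
          ≈⟨ extendʳ (Hom-F.F-square π₁-⟨⟩) ⟩
        post (F.F₁ g) ∘ (post (F.F₁ π₁) ∘ with-parameter B′)
          ≈⟨ ∘-respʳ (π₁-pair (weaken id) const-id) ⟩
        post (F.F₁ g) ∘ weaken id                ≈⟨ post-⊙ (F.F₁ g) ⟩
        weaken (□.F₁ g ∘ id)
          ≈⟨ ⊙-resp Equiv.refl (Equiv.trans identityʳ (Equiv.sym identityˡ)) ⟩
        weaken (id ∘ □.F₁ g)                     ≈⟨ weaken-∘ ⟨
        weaken id ∘ □.F₁ g                       ≈⟨ pullˡ (π₁-pair (weaken id) const-id) ⟨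
        post (F.F₁ π₁) ∘ (with-parameter B ∘ □.F₁ g) ∎)
      (begin
        post (F.F₁ π₂) ∘ (post (F.F₁ (g ⁂ id)) ∘ with-parameter B′)
          ≈⟨ pullˡ (Hom-F.F-triangle (Equiv.trans π₂-⟨⟩ identityˡ)) ⟩
        post (F.F₁ π₂) ∘ with-parameter B′       ≈⟨ π₂-pair (weaken id) const-id ⟩
        const-id                                 ≈⟨ const-id-∘ ⟨
        const-id ∘ □.F₁ g                        ≈⟨ pullˡ (π₂-pair (weaken id) const-id) ⟨
        post (F.F₁ π₂) ∘ (with-parameter B ∘ □.F₁ g) ∎)
      where open HomReasoning

    -- The fixpoint operator.

    module _ {B : Obj} where
      unroll : (B ×̂ □.F₀ A) ⇒ A → (B ×̂ D) ⇒ A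
      unroll f = f ∘ (id ⁂ (self-apply ∘ unfold))

      code : (B ×̂ □.F₀ A) ⇒ A → □.F₀ B ⇒ H
      code f = post (F.F₁ (unroll f)) ∘ with-parameter B

      fix : (B ×̂ □.F₀ A) ⇒ A → □.F₀ B ⇒ □.F₀ A
      fix f = self-apply ∘ code f

      fix-resp : ∀ {f g} → f ≈ g → fix f ≈ fix g
      fix-resp {f} {g} p = ∘-respʳ (∘-respˡ (Hom-F.F-resp-≈ (∘-respˡ p)))

      -- Applying `code f` to its own quotation `x` evaluates `unroll f` at the pair of the
      -- parameter and `x`. There `x` is unfolded and self-applied under `□`, which yields `δ₀ A` of
      -- the fixpoint.
      fix-fixed : ∀ f → fix f ≈ □.F₁ f ∘
        (_≅_.to (×≅G× 𝓑-limits 𝓑-limits □-preserves B (□.F₀ A)) ∘ ⟨ id , δ₀ A ∘ fix f ⟩)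
      fix-fixed f = begin
        self-apply ∘ code f                       ≈⟨ ⊙-∘ ⟩
        (quote-folded ∘ code f) ⊙ (id ∘ code f)   ≈⟨ ⊙-resp Equiv.refl identityˡ ⟩
        -- At source `⊤ᶜ`, `post (F.F₁ _)` is `□.F₁ _` by definition.
        x ⊙ (post (F.F₁ (unroll f)) ∘ with-parameter B) ≈⟨ post-⊙ (F.F₁ (unroll f)) ⟨
        □.F₁ (unroll f) ∘ y                       ≈⟨ ∘-respˡ □.homomorphism ⟩
        (□.F₁ f ∘ □.F₁ (id ⁂ (self-apply ∘ unfold))) ∘ y ≈⟨ assoc ⟩
        □.F₁ f ∘ (□.F₁ (id ⁂ (self-apply ∘ unfold)) ∘ y)
          ≈⟨ ∘-respʳ (G×-unique 𝓑-limits 𝓑-limits □-preserves first second) ⟩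
        □.F₁ f ∘ (to ∘ ⟨ id , δ₀ A ∘ fix f ⟩)     ∎
        where
          open HomReasoning
          open _≅_ (×≅G× 𝓑-limits 𝓑-limits □-preserves B (□.F₀ A)) using (to)
          module G× = Pullback (PreservesFiniteLimits.mapPullback □-preserves (product B (□.F₀ A)))

          x : □.F₀ B ⇒ □.F₀ D
          x = quote-folded ∘ code f

          -- The pair of the parameter and `x`, as `π₁y` and `π₂y` confirm.
          y : □.F₀ B ⇒ □.F₀ (B ×̂ D)
          y = x ⊙ with-parameter B

          π₁y : □.F₁ π₁ ∘ y ≈ id
          π₁y = begin
            □.F₁ π₁ ∘ y                               ≈⟨ post-⊙ (F.F₁ π₁) ⟩
            x ⊙ (post (F.F₁ π₁) ∘ with-parameter B)
              ≈⟨ ⊙-resp Equiv.refl (π₁-pair (weaken id) const-id) ⟩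
            x ⊙ weaken id                             ≈⟨ ⊙-weaken ⟩
            id                                        ∎

          π₂y : □.F₁ π₂ ∘ y ≈ x
          π₂y = begin
            □.F₁ π₂ ∘ y                               ≈⟨ post-⊙ (F.F₁ π₂) ⟩
            x ⊙ (post (F.F₁ π₂) ∘ with-parameter B)
              ≈⟨ ⊙-resp Equiv.refl (π₂-pair (weaken id) const-id) ⟩
            x ⊙ const-id                              ≈⟨ ⊙-identityʳ ⟩
            x                                         ∎

          first : □.F₁ π₁ ∘ (□.F₁ (id ⁂ (self-apply ∘ unfold)) ∘ y) ≈
                  □.F₁ π₁ ∘ (to ∘ ⟨ id , δ₀ A ∘ fix f ⟩)
          first = begin
            □.F₁ π₁ ∘ (□.F₁ (id ⁂ (self-apply ∘ unfold)) ∘ y)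
              ≈⟨ pullˡ (□.F-triangle (Equiv.trans π₁-⟨⟩ identityˡ)) ⟩
            □.F₁ π₁ ∘ y                               ≈⟨ π₁y ⟩
            id                                        ≈⟨ π₁-⟨⟩ ⟨
            π₁ ∘ ⟨ id , δ₀ A ∘ fix f ⟩                ≈⟨ pullˡ G×.p₁∘universal ⟨
            □.F₁ π₁ ∘ (to ∘ ⟨ id , δ₀ A ∘ fix f ⟩)    ∎

          second : □.F₁ π₂ ∘ (□.F₁ (id ⁂ (self-apply ∘ unfold)) ∘ y) ≈
                   □.F₁ π₂ ∘ (to ∘ ⟨ id , δ₀ A ∘ fix f ⟩)
          second = begin
            □.F₁ π₂ ∘ (□.F₁ (id ⁂ (self-apply ∘ unfold)) ∘ y)
              ≈⟨ extendʳ (□.F-square π₂-⟨⟩) ⟩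
            □.F₁ (self-apply ∘ unfold) ∘ (□.F₁ π₂ ∘ y) ≈⟨ ∘-respʳ π₂y ⟩
            □.F₁ (self-apply ∘ unfold) ∘ x            ≈⟨ ∘-respˡ □.homomorphism ⟩
            (□.F₁ self-apply ∘ □.F₁ unfold) ∘ x       ≈⟨ assoc ⟩
            □.F₁ self-apply ∘ (□.F₁ unfold ∘ (quote-folded ∘ code f))
              ≈⟨ ∘-respʳ (pullˡ □unfold∘quote-folded) ⟩
            □.F₁ self-apply ∘ (quote-hom ∘ code f)    ≈⟨ extendʳ δ₀∘self-apply ⟨
            δ₀ A ∘ fix f                              ≈⟨ π₂-⟨⟩ ⟨
            π₂ ∘ ⟨ id , δ₀ A ∘ fix f ⟩                ≈⟨ pullˡ G×.p₂∘universal ⟨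
            □.F₁ π₂ ∘ (to ∘ ⟨ id , δ₀ A ∘ fix f ⟩)    ∎

    -- `g` acts on the parameter and `s` on the recursive argument, so they commute in `unroll`;
    -- `with-parameter-natural` then moves `g` out as `□ g`.
    fix-natural : ∀ {B B′} (g : B′ ⇒ B) (f : (B ×̂ □.F₀ A) ⇒ A) →
                  fix (f ∘ (g ⁂ id)) ≈ fix f ∘ □.F₁ g
    fix-natural {B} {B′} g f = begin
      self-apply ∘ (post (F.F₁ (unroll (f ∘ (g ⁂ id)))) ∘ with-parameter B′)
        ≈⟨ ∘-respʳ (∘-respˡ (Equiv.trans (Hom-F.F-resp-≈ unroll-∘) Hom-F.homomorphism)) ⟩
      self-apply ∘ ((post (F.F₁ (unroll f)) ∘ post (F.F₁ (g ⁂ id))) ∘ with-parameter B′)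
        ≈⟨ ∘-respʳ assoc ⟩
      self-apply ∘ (post (F.F₁ (unroll f)) ∘ (post (F.F₁ (g ⁂ id)) ∘ with-parameter B′))
        ≈⟨ ∘-respʳ (∘-respʳ (with-parameter-natural g)) ⟩
      self-apply ∘ (post (F.F₁ (unroll f)) ∘ (with-parameter B ∘ □.F₁ g))
        ≈⟨ ∘-respʳ sym-assoc ⟩
      self-apply ∘ (code f ∘ □.F₁ g)
        ≈⟨ sym-assoc ⟩
      fix f ∘ □.F₁ g ∎
      where
        open HomReasoning
        s : D ⇒ □.F₀ A
        s = self-apply ∘ unfold
        ⁂-swap : (g ⁂ id) ∘ (id ⁂ s) ≈ (id ⁂ s) ∘ (g ⁂ id)
        ⁂-swap = ×-unique
          (begin
            π₁ ∘ ((g ⁂ id) ∘ (id ⁂ s))  ≈⟨ extendʳ π₁-⟨⟩ ⟩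
            g ∘ (π₁ ∘ (id ⁂ s))         ≈⟨ ∘-respʳ (Equiv.trans π₁-⟨⟩ identityˡ) ⟩
            g ∘ π₁                      ≈⟨ π₁-⟨⟩ ⟨
            π₁ ∘ (g ⁂ id)               ≈⟨ pullˡ (Equiv.trans π₁-⟨⟩ identityˡ) ⟨
            π₁ ∘ ((id ⁂ s) ∘ (g ⁂ id))  ∎)
          (begin
            π₂ ∘ ((g ⁂ id) ∘ (id ⁂ s))  ≈⟨ pullˡ (Equiv.trans π₂-⟨⟩ identityˡ) ⟩
            π₂ ∘ (id ⁂ s)               ≈⟨ π₂-⟨⟩ ⟩
            s ∘ π₂                      ≈⟨ ∘-respʳ (Equiv.trans π₂-⟨⟩ identityˡ) ⟨
            s ∘ (π₂ ∘ (g ⁂ id))         ≈⟨ extendʳ π₂-⟨⟩ ⟨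
            π₂ ∘ ((id ⁂ s) ∘ (g ⁂ id))  ∎)
        unroll-∘ : unroll (f ∘ (g ⁂ id)) ≈ unroll f ∘ (g ⁂ id)
        unroll-∘ = Equiv.trans assoc (Equiv.trans (∘-respʳ ⁂-swap) sym-assoc)

  fixpointOperator : FixpointOperator 𝓑-limits □-preserves δ
  fixpointOperator = record
    { _†        = fix
    ; †-resp-≈  = fix-resp
    ; †-natural = fix-natural
    ; †-fixed   = fix-fixed
    }

theorem6p16 : ∀ {o ℓ e : Level} (𝓖 : GeminalCategory o ℓ e) →
    let open GeminalCategory 𝓖 in
    Σ[ δ ∈ NaturalTransformation □ (□ ∘F □) ]
    (CoAssociative δ × FixpointOperator 𝓑-limits □-preserves δ)
theorem6p16 𝓖 = δ , δ-coassoc , fixpointOperator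
  where open FixpointConstruction (GeminalCategory.preGeminal 𝓖) (GeminalCategory.ℍ-coassoc 𝓖)
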